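{- Let $S$ be a connected graph on at least 3 vertices. Then the following two equivalences hold. (i) Every longest cycle of every 2-connected $S$-free graph $G$ is a heavy cycle of $G$ if and only if $S$ is (isomorphic to) $P_3$, $K_{1,3}$ or $K_{1,4}$. (ii) Every longest cycle of every 2-connected $S$-heavy graph $G$ is a heavy cycle of $G$ if and only if $S$ is (isomorphic to) $P_3$, $K_{1,3}$ or $K_{1,4}$.
   Context: All graphs are finite and simple. Let $G$ be a graph on $n$ vertices. A vertex $v$ of $G$ is called heavy if its degree satisfies $d(v)\geq n/2$. A cycle $C$ of $G$ is called heavy if $C$ contains all heavy vertices of $G$. For a given graph $H$, $G$ is $H$-free if $G$ contains no induced subgraph isomorphic to $H$; $G$ is $H$-heavy if every induced subgraph of $G$ isomorphic to $H$ contains two vertices that are nonadjacent and whose degrees in $G$ have sum at least $n$. $P_3$ denotes the path on 3 vertices and $K_{1,m}$ the star with $m$ leaves. -}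

module Defs where

open import Data.Fin.Base using (Fin; zero; toℕ)
open import Data.Fin.Properties as Fin using (_≟_)
open import Data.Fin.Subset using (Subset; ∁; ∣_∣) renaming (_∈_ to _∈ₛ_)
open import Data.List.Base as List using (List; _∷_; _∷ʳ_)
open import Data.List.Membership.Propositional using (_∈_)
open import Data.List.Relation.Unary.Linked using (Linked)
open import Data.List.Relation.Unary.Unique.Propositional using (Unique)
open import Data.Nat.Base as ℕ using (ℕ; suc; _+_; _*_; _≤_; _<_)
open import Data.Nat.Properties as ℕ using (1+n≢n)
open import Data.Product.Base using (_×_; _,_; ∃; ∃-syntax; proj₁)
open import Data.Sum.Base using (_⊎_; inj₁; inj₂; swap)
open import Data.Vec.Base using (count; allFin)
open import Function.Base using (_on_)
open import Function.Bundles using (_↔_; _⇔_; Inverse)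
open import Level using (0ℓ)
open import Relation.Binary.Construct.Closure.ReflexiveTransitive using (Star)
open import Relation.Binary.Core using (Rel)
open import Relation.Binary.Definitions using (Decidable; Irreflexive; Symmetric)
open import Relation.Binary.PropositionalEquality.Core
  using (_≡_; _≢_; refl; cong)
open import Relation.Nullary.Decidable.Core using (_×-dec_; _⊎-dec_; ¬?)
open import Relation.Nullary.Negation.Core using (¬_)

-- Simple graphs with vertex set V. Finite graphs are those with V = Fin n;
-- a general V is allowed so that the induced subgraph G [ W ] can have
-- the members of W as its vertices.

record Graph (V : Set) : Set₁ where
  field
    Adj    : Rel V 0ℓ
    adj?   : Decidable Adj
    sym    : Symmetric Adj
    irrefl : Irreflexive _≡_ Adj

open Graph public using (Adj; adj?)

record _≅_ {V W : Set} (G : Graph V) (H : Graph W) : Set where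
  field
    bijection : V ↔ W
  open Inverse bijection public using (to; from)
  field
    adjacency : ∀ u v → Adj G u v ⇔ Adj H (to u) (to v)

infix 4 _≅_

_[_] : ∀ {n} → Graph (Fin n) → (W : Subset n) → Graph (∃ λ v → v ∈ₛ W)
G [ W ] = record
  { Adj    = Adj G on proj₁
  ; adj?   = λ u v → adj? G (proj₁ u) (proj₁ v)
  ; sym    = Graph.sym G
  ; irrefl = λ u≡v → Graph.irrefl G (cong proj₁ u≡v)
  }

path : ∀ n → Graph (Fin n)
path n = record
  { Adj    = λ u v → suc (toℕ u) ≡ toℕ v ⊎ suc (toℕ v) ≡ toℕ u
  ; adj?   = λ u v → (suc (toℕ u) ℕ.≟ toℕ v) ⊎-dec (suc (toℕ v) ℕ.≟ toℕ u)
  ; sym    = swap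
  ; irrefl = λ { refl (inj₁ e) → 1+n≢n e ; refl (inj₂ e) → 1+n≢n e }
  }

-- K₁,ₘ with centre zero.

star : ∀ m → Graph (Fin (suc m))
star m = record
  { Adj    = λ u v → (u ≡ zero × v ≢ zero) ⊎ (v ≡ zero × u ≢ zero)
  ; adj?   = λ u v → ((u ≟ zero) ×-dec ¬? (v ≟ zero))
               ⊎-dec ((v ≟ zero) ×-dec ¬? (u ≟ zero))
  ; sym    = swap
  ; irrefl = λ { refl (inj₁ (e , ne)) → ne e ; refl (inj₂ (e , ne)) → ne e }
  }

Connected : ∀ {V} → Graph V → Set
Connected G = ∀ u v → Star (Adj G) u v

_-Connected_ : ∀ {n} → ℕ → Graph (Fin n) → Set
_-Connected_ {n} k G =
  k < n × (∀ (X : Subset n) → ∣ X ∣ < k → Connected (G [ ∁ X ]))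

degree : ∀ {n} → Graph (Fin n) → Fin n → ℕ
degree {n} G v = count (adj? G v) (allFin n)

-- d(v) ≥ n/2, cleared of the denominator.

HeavyVertex : ∀ {n} → Graph (Fin n) → Fin n → Set
HeavyVertex {n} G v = n ≤ 2 * degree G v

_-Free_ : ∀ {m n} → Graph (Fin m) → Graph (Fin n) → Set
H -Free G = ∀ W → ¬ (G [ W ] ≅ H)

_-Heavy_ : ∀ {m n} → Graph (Fin m) → Graph (Fin n) → Set
_-Heavy_ {n = n} H G = ∀ W → G [ W ] ≅ H →
  ∃[ u ] ∃[ v ] u ∈ₛ W × v ∈ₛ W × u ≢ v × ¬ Adj G u v
              × n ≤ degree G u + degree G v

-- A cycle is presented by listing its vertices in cyclic order from some
-- starting vertex, in one of the two directions.

record Cycle {n} (G : Graph (Fin n)) : Set where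
  field
    start    : Fin n
    rest     : List (Fin n)
    distinct : Unique (start ∷ rest)
    closed   : Linked (Adj G) (start ∷ (rest ∷ʳ start))

  vertices : List (Fin n)
  vertices = start ∷ rest

  length : ℕ
  length = List.length vertices

  field
    length≥3 : 3 ≤ length

Longest : ∀ {n} {G : Graph (Fin n)} → Cycle G → Set
Longest {G = G} C = ∀ (D : Cycle G) → Cycle.length D ≤ Cycle.length C

HeavyCycle : ∀ {n} {G : Graph (Fin n)} → Cycle G → Set
HeavyCycle {G = G} C = ∀ v → HeavyVertex G v → v ∈ Cycle.vertices C

EveryLongestCycleHeavy : ∀ {n} → Graph (Fin n) → Set
EveryLongestCycleHeavy G = ∀ (C : Cycle G) → Longest C → HeavyCycle C

{-# OPTIONS --safe #-}
module Submission where

-- Sufficiency.  Call u and v an Ore pair if they are adjacent or d(u) + d(v) ≥ n; a cycle of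
-- Ore pairs can be turned into a cycle at least as long, so a longest cycle C is also longest
-- among those.  If a heavy vertex v is missed by C, take two arms from v to C, disjoint and
-- starting with edges, of maximal total length.  Comparing C with its detours through v shows
-- that C is so long, and hence the degree of v so large, that v has many neighbours A outside
-- the arms and C.  If the first vertices of the arms form no Ore pair, K₁,₄-heaviness makes A a
-- clique of Ore pairs, which can be inserted into an arm.  Otherwise v may be skipped, and an
-- arm can be re-entered at its last neighbour of v; A splits into at most two Ore paths, each of
-- which then has at most as many vertices as there are non-neighbours of v on the arms.
--
-- Necessity.  G₀ has no induced P₄ or C₄, G₁ is bipartite and G₂ has no induced K₁,₅; all three
-- have a longest cycle missing a heavy vertex.  So S has neither a triangle nor an induced P₄ or
-- C₄, hence is a star, with fewer than five leaves.

open import Defs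
open import Algebra.Solver.CommutativeMonoid as CMSolver using ()
open import Data.Fin.Subset using (Subset; ∁; ⁅_⁆; ∣_∣) renaming (_∈_ to _∈ₛ_; ⊥ to ∅)
open import Data.Fin.Subset.Properties using (x∈⁅x⁆; x∈⁅y⁆⇒x≡y; x∉p⇒x∈∁p; x∈p⇒∣p-x∣<∣p∣; x∈p∧x≢y⇒x∈p-y; x∈∁p⇒x∉p; ∣⊥∣≡0; ∣⁅x⁆∣≡1; ∉⊥) renaming (_∈?_ to _∈ₛ?_)
open import Relation.Binary.Construct.Closure.ReflexiveTransitive using (Star; ε; _◅_; _◅◅_; gmap)
import Relation.Binary.Construct.Closure.ReflexiveTransitive as Star
open import Data.Unit.Base using (tt)
open import Data.Empty using (⊥; ⊥-elim)
open import Data.Fin.Base using (Fin; zero; suc; toℕ; inject≤)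
open import Data.Fin using (fromℕ; #_)
open import Data.Bool.Base using (Bool; true; false; _∧_; _∨_; if_then_else_; T)
open import Data.Bool.Properties as Bool using (T?; ∨-comm)
open import Data.List.Relation.Unary.Unique.DecPropositional using (unique?)
open import Data.Fin.Patterns using (0F; 1F; 2F; 3F)
open import Function.Bundles using (_⇔_; mk⇔; mk↔ₛ′; Equivalence; Inverse)
open import Data.Vec.Properties.WithK using ([]=-irrelevant)
open import Data.Fin.Permutation using (transpose)
import Function.Construct.Symmetry as Symmetry
import Function.Construct.Composition as Composition
open import Data.Vec.Properties as Vec using (lookup⇒[]=; []=⇒lookup; lookup∘tabulate)
open import Data.Fin.Properties as Fin using (_≟_; any?; all?; inject≤-injective)
open import Data.List.Base as List using (List; []; _∷_; _++_; _∷ʳ_; length; reverse; filter)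
  renaming ([_] to ⟨_⟩)
open import Data.List.Properties as List using (length-++; length-reverse; ++-assoc; unfold-reverse; ++-identityʳ)
open import Data.List.Membership.Propositional using (_∈_; _∉_)
open import Data.List.Membership.Propositional.Properties
  using (∈-++⁺ˡ; ∈-++⁺ʳ; ∈-++⁻; ∈-∃++; ∈-filter⁻; ∈-allFin)
import Data.List.Membership.DecPropositional as DecMembership
open import Data.List.Relation.Unary.All as All using (All; []; _∷_)
import Data.List.Relation.Unary.All.Properties as All
open import Data.List.Relation.Unary.AllPairs as AllPairs using ([]; _∷_)
open import Data.List.Relation.Unary.Any using (here; there)
open import Data.List.Relation.Unary.Linked as Linked using (Linked; []; [-]; _∷_)
open import Data.List.Relation.Unary.Unique.Propositional using (Unique)
open import Data.List.Relation.Unary.Unique.Propositional.Properties as Unique using (allFin⁺)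
open import Data.List.Relation.Binary.Permutation.Propositional as ↭
  using (_↭_; ↭-refl; ↭-sym; ↭-trans; ↭-reflexive)
open import Data.List.Relation.Binary.Permutation.Propositional.Properties as ↭
  using (∈-resp-↭; ↭-length; ++⁺ˡ; ++⁺ʳ; ++⁺; shift; ↭-reverse; filter-↭; ++-commutativeMonoid; ∷↭∷ʳ)
import Data.List.Relation.Binary.Permutation.Setoid.Properties as ↭ₛ
open import Data.Nat.Base as ℕ using (ℕ; zero; suc; _+_; _*_; _≤_; _<_; z≤n; s≤s)
open import Data.Nat.Properties as ℕ using ()
open import Data.Nat.Tactic.RingSolver using (solve-∀)
open import Data.Product.Base using (_×_; _,_; ∃; proj₁; proj₂)
open import Data.Sum.Base using (_⊎_; inj₁; inj₂; [_,_]′)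
open import Data.Vec.Base as Vec using ()
open import Function.Base using (_∘_; id; case_of_)
open import Level using (0ℓ)
open import Relation.Binary.Core using (Rel)
open import Relation.Binary.Definitions using (Symmetric)
import Relation.Binary.Definitions as Rel
open import Relation.Binary.PropositionalEquality hiding ([_])
open import Relation.Nullary using (¬_; Dec; yes; no; does)
open import Relation.Nullary.Decidable using (dec-true; map′; toWitness; _→-dec_; _×-dec_; _⊎-dec_; ¬?)
open import Relation.Unary using (Pred; Decidable)

-- The star condition supplies pairs of large degree sum rather than edges, so all paths built
-- around `v` consist of Ore pairs; only the first step of an arm stays an edge, because the leaves
-- of a star at `v` must be neighbours of `v`. The counts are matched to each other. Let the arms
-- have s inner vertices, k of them not adjacent to `v`. The detours give |C| ≥ 2s + 2d, where d is
-- the number of neighbours of `v` on C, and with 2d(v) ≥ n this becomes |A| ≥ s + 2k + 1. The term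
-- s defeats a single Ore path through A, which would be a better arm; the term 2k defeats two Ore
-- paths of at most k vertices each. How many paths are needed depends on how many first vertices
-- can be leaves of the star. If both can, two far vertices of A already complete a forbidden star.
-- If the first vertices form an Ore pair, only one can, and A merely lacks three pairwise far
-- vertices; the sharper bound k compensates for the second path.

-- A linear consequence of A ≤ B is certified by a semiring identity with slack s.
linear : ∀ {A B} a b s → A ≤ B → a + B + s ≡ b + A → a ≤ b
linear {A} {B} a b s A≤B eq = ℕ.+-cancelʳ-≤ A a b (begin
  a + A      ≤⟨ ℕ.+-monoʳ-≤ a A≤B ⟩
  a + B      ≤⟨ ℕ.m≤m+n (a + B) s ⟩
  a + B + s  ≡⟨ eq ⟩
  b + A      ∎)
  where open ℕ.≤-Reasoning

infixr 4 _&_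
_&_ : ∀ {a b c d} → a ≤ b → c ≤ d → a + c ≤ b + d
_&_ = ℕ.+-mono-≤

-- Lists up to permutation, counting, and walks

module _ where

  private variable
    A : Set
    E E′ : Rel A 0ℓ
    a b x y z : A
    l m xs ys zs : List A
    P Q : Pred A 0ℓ

  unique-resp-↭ : xs ↭ ys → Unique xs → Unique ys
  unique-resp-↭ p u = ↭ₛ.Unique-resp-↭ (setoid _) (↭.↭⇒↭ₛ p) u

  unique-++ˡ : ∀ (xs : List A) {ys} → Unique (xs ++ ys) → Unique xs
  unique-++ˡ [] u = []
  unique-++ˡ (x ∷ xs) (p ∷ u) = All.++⁻ˡ xs p ∷ unique-++ˡ xs u

  unique-++ʳ : ∀ (xs : List A) {ys} → Unique (xs ++ ys) → Unique ys
  unique-++ʳ [] u = u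
  unique-++ʳ (x ∷ xs) (_ ∷ u) = unique-++ʳ xs u

  unique-⊑ : ∀ (zs : List A) → Unique xs → xs ↭ ys ++ zs → Unique ys
  unique-⊑ {ys = ys} zs u p = unique-++ˡ ys (unique-resp-↭ p u)

  unique-disjoint : ∀ (xs : List A) {ys} → Unique (xs ++ ys) → x ∈ xs → x ∈ ys → ⊥
  unique-disjoint (x ∷ xs) (p ∷ u) (here refl) j = All.lookup p (∈-++⁺ʳ xs j) refl
  unique-disjoint (x ∷ xs) (p ∷ u) (there i) j = unique-disjoint xs u i j

  unique-++ : Unique xs → Unique ys → (∀ {x} → x ∈ xs → x ∈ ys → ⊥) → Unique (xs ++ ys)
  unique-++ u v d = Unique.++⁺ u v (λ (i , j) → d i j)

  unique-∷ : x ∉ xs → Unique xs → Unique (x ∷ xs)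
  unique-∷ x∉ u = All.tabulate (λ { i refl → x∉ i }) ∷ u

  ∉-head : Unique (x ∷ xs) → x ∉ xs
  ∉-head (p ∷ _) i = All.lookup p i refl

  ∈-∃↭ : x ∈ xs → ∃ λ ys → xs ↭ x ∷ ys
  ∈-∃↭ {x = x} i with ys , zs , refl ← ∈-∃++ i = ys ++ zs , shift x ys zs

  complement : ∀ {L M : List A} → Unique M → (∀ {x} → x ∈ M → x ∈ L) → ∃ λ N → L ↭ M ++ N
  complement {L = L} {[]} u s = L , ↭-refl
  complement {L = L} {a ∷ M} (p ∷ u) s
    with L′ , e ← ∈-∃↭ (s (here refl))
    with N , e′ ← complement {L = L′} u
           (λ i → case ∈-resp-↭ e (s (there i)) of λ
             { (here refl) → ⊥-elim (All.lookup p i refl) ; (there j) → j })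
    = N , ↭-trans e (↭.prep a e′)

  count : ∀ {A : Set} {P : Pred A 0ℓ} → Decidable P → List A → ℕ
  count P? l = length (filter P? l)

  module _ {A : Set} {P : Pred A 0ℓ} (P? : Decidable P) where

    private variable
      u : A
      us vs : List A

    count-++ : ∀ xs ys → count P? (xs ++ ys) ≡ count P? xs + count P? ys
    count-++ xs ys = trans (cong length (List.filter-++ P? xs ys)) (length-++ (filter P? xs))

    count-++-≤ˡ : ∀ xs ys → count P? xs ≤ count P? (xs ++ ys)
    count-++-≤ˡ xs ys = subst (count P? xs ≤_) (sym (count-++ xs ys)) (ℕ.m≤m+n _ _)

    count-++-≤ʳ : ∀ xs ys → count P? ys ≤ count P? (xs ++ ys)
    count-++-≤ʳ xs ys = subst (count P? ys ≤_) (sym (count-++ xs ys)) (ℕ.m≤n+m _ (count P? xs))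

    count-↭ : us ↭ vs → count P? us ≡ count P? vs
    count-↭ p = ↭-length (filter-↭ P? p)

    count-accept : P u → count P? (u ∷ us) ≡ suc (count P? us)
    count-accept px = cong length (List.filter-accept P? px)

    count-reject : ¬ P u → count P? (u ∷ us) ≡ count P? us
    count-reject ¬px = cong length (List.filter-reject P? ¬px)

    count-∷≤ : ∀ x xs → count P? (x ∷ xs) ≤ suc (count P? xs)
    count-∷≤ x xs with P? x
    ... | yes p = ℕ.≤-refl
    ... | no ¬p = ℕ.n≤1+n _

    count-≤ : ∀ xs → count P? xs ≤ length xs
    count-≤ = List.length-filter P?

    -- The tail after the last hit is free of hits; this serves loop erasure, leaving a set for the
    -- last time, and finding the last neighbour of `v` on an arm.
    splitLast : ∀ xs → All (¬_ ∘ P) xs ⊎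
      ∃ λ ys → ∃ λ x → ∃ λ zs → xs ≡ ys ++ x ∷ zs × P x × All (¬_ ∘ P) zs
    splitLast [] = inj₁ []
    splitLast (x ∷ xs) with splitLast xs | P? x
    ... | inj₂ (ys , z , zs , refl , pz , none) | _ = inj₂ (x ∷ ys , z , zs , refl , pz , none)
    ... | inj₁ none | yes p = inj₂ ([] , x , xs , refl , p , none)
    ... | inj₁ none | no ¬p = inj₁ (¬p ∷ none)

  count-tabulate : ∀ {A : Set} {n} {P : Pred A 0ℓ} (P? : Decidable P) (f : Fin n → A) →
    Vec.count P? (Vec.tabulate f) ≡ count P? (List.tabulate f)
  count-tabulate {n = zero} P? f = refl
  count-tabulate {n = suc n} P? f with P? (f zero)
  ... | yes _ = cong suc (count-tabulate P? (f ∘ suc))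
  ... | no _ = count-tabulate P? (f ∘ suc)

  -- Walk E a l b: l lists the internal vertices of a walk from a to b.
  data Walk {A : Set} (E : Rel A 0ℓ) : A → List A → A → Set where
    edge : E a b → Walk E a [] b
    _∷_ : E a x → Walk E x l b → Walk E a (x ∷ l) b

  walk-map : (∀ {x y} → E x y → E′ x y) → Walk E a l b → Walk E′ a l b
  walk-map f (edge r) = edge (f r)
  walk-map f (r ∷ w) = f r ∷ walk-map f w

  _⟫_ : Walk E a l x → Walk E x m b → Walk E a (l ++ x ∷ m) b
  edge r ⟫ w = r ∷ w
  (r ∷ v) ⟫ w = r ∷ (v ⟫ w)

  infixr 5 _⟫_

  walk-split : ∀ l → Walk E a (l ++ x ∷ m) b → Walk E a l x × Walk E x m b
  walk-split [] (r ∷ w) = edge r , w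
  walk-split (y ∷ l) (r ∷ w) with v , w′ ← walk-split l w = r ∷ v , w′

  walk-reverse : Symmetric E → Walk E a l b → Walk E b (reverse l) a
  walk-reverse s (edge r) = edge (s r)
  walk-reverse {E = E} {a = a} {b = b} s (_∷_ {x = x} {l = l} r w) =
    subst (λ k → Walk E b k a) (sym (unfold-reverse x l)) (walk-reverse s w ⟫ edge (s r))

  linked⇒walk : ∀ l → Linked E (a ∷ (l ∷ʳ b)) → Walk E a l b
  linked⇒walk [] (r ∷ _) = edge r
  linked⇒walk (x ∷ l) (r ∷ w) = r ∷ linked⇒walk l w

  walk⇒linked : Walk E a l b → Linked E (a ∷ (l ∷ʳ b))
  walk⇒linked (edge r) = r ∷ [-]
  walk⇒linked (r ∷ w) = r ∷ walk⇒linked w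

open module ListSolver {A : Set} = CMSolver (++-commutativeMonoid {A = A}) public
  using (solve; _⊜_; _⊕_)


infixl 3 _▹_
_▹_ : ∀ {A : Set} {xs ys zs : List A} → xs ↭ ys → ys ↭ zs → xs ↭ zs
_▹_ = ↭-trans

open module FinMembership {n} = DecMembership (_≟_ {n}) public using (_∈?_)

-- Ore pairs and longest cycles

module _ {n} (G : Graph (Fin n)) where

  private
    V = Fin n
    _~_ = Adj G

  ~-sym : ∀ {u v} → u ~ v → v ~ u
  ~-sym = Graph.sym G

  ~-irrefl : ∀ {u} → ¬ u ~ u
  ~-irrefl = Graph.irrefl G refl

  nbrs : V → List V → ℕ
  nbrs v = count (adj? G v)

  degree-nbrs : ∀ v → degree G v ≡ nbrs v (List.allFin n)
  degree-nbrs v = count-tabulate (adj? G v) id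

  nbrs-∌ : ∀ {u v} xs → ¬ u ~ v → nbrs u (v ∷ xs) ≡ nbrs u xs
  nbrs-∌ {u} xs = count-reject (adj? G u) {us = xs}

  outside : ∀ {M} → Unique M → ∃ λ N → List.allFin n ↭ M ++ N
  outside u = complement u (λ _ → ∈-allFin _)

  length-allFin : length (List.allFin n) ≡ n
  length-allFin = List.length-tabulate id

  length-outside : ∀ M {N} → List.allFin n ↭ M ++ N → length M + length N ≡ n
  length-outside M p = trans (sym (length-++ M)) (trans (sym (↭-length p)) length-allFin)

  degree-outside : ∀ v M {N} → List.allFin n ↭ M ++ N → degree G v ≡ nbrs v M + nbrs v N
  degree-outside v M {N} p = trans (degree-nbrs v)
    (trans (count-↭ (adj? G v) p) (count-++ (adj? G v) M N))

  Ore : Rel V 0ℓ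
  Ore u v = u ~ v ⊎ (u ≢ v × n ≤ degree G u + degree G v)

  ore? : Rel.Decidable Ore
  ore? u v = adj? G u v ⊎-dec (¬? (u ≟ v) ×-dec (n ℕ.≤? _))

  ore-sym : Symmetric Ore
  ore-sym (inj₁ e) = inj₁ (~-sym e)
  ore-sym {u} {v} (inj₂ (ne , le)) =
    inj₂ (ne ∘ sym , subst (n ≤_) (ℕ.+-comm (degree G u) (degree G v)) le)

  gap : V → V → ℕ
  gap u v with adj? G u v
  ... | yes _ = 0
  ... | no  _ = 1

  -- Termination measure for repairing an Ore cycle: each repair lowers it and loses no vertex.
  deficit : V → List V → V → ℕ
  deficit a [] b = gap a b
  deficit a (x ∷ l) b = gap a x + deficit x l b

  gap-adj : ∀ {u v} → u ~ v → gap u v ≡ 0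
  gap-adj {u} {v} e with adj? G u v
  ... | yes _ = refl
  ... | no ¬e = ⊥-elim (¬e e)

  gap-¬adj : ∀ {u v} → ¬ u ~ v → gap u v ≡ 1
  gap-¬adj {u} {v} ¬e with adj? G u v
  ... | yes e = ⊥-elim (¬e e)
  ... | no _ = refl

  gap-sym : ∀ u v → gap u v ≡ gap v u
  gap-sym u v with adj? G u v
  ... | yes e = sym (gap-adj (~-sym e))
  ... | no ¬e = sym (gap-¬adj (¬e ∘ ~-sym))

  deficit-++ : ∀ a l x m b → deficit a (l ++ x ∷ m) b ≡ deficit a l x + deficit x m b
  deficit-++ a [] x m b = refl
  deficit-++ a (y ∷ l) x m b = trans (cong (gap a y +_) (deficit-++ y l x m b))
    (sym (ℕ.+-assoc (gap a y) _ _))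

  deficit-reverse : ∀ a l b → deficit b (reverse l) a ≡ deficit a l b
  deficit-reverse a [] b = gap-sym b a
  deficit-reverse a (x ∷ l) b = begin
    deficit b (reverse (x ∷ l)) a         ≡⟨ cong (λ k → deficit b k a) (unfold-reverse x l) ⟩
    deficit b (reverse l ++ x ∷ []) a     ≡⟨ deficit-++ b (reverse l) x [] a ⟩
    deficit b (reverse l) x + gap x a     ≡⟨ cong₂ _+_ (deficit-reverse x l b) (gap-sym x a) ⟩
    deficit x l b + gap a x               ≡⟨ ℕ.+-comm _ (gap a x) ⟩
    gap a x + deficit x l b               ∎
    where open ≡-Reasoning

  record IsCycle (E : Rel V 0ℓ) (a : V) (l : List V) : Set where
    constructor cyc
    field
      walk : Walk E a l a
      unique : Unique (a ∷ l)
      long : 2 ≤ length l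

  -- Counting `v` only on the tail pairs each position with its successor. Without a crossing each
  -- such pair contributes at most one; the last entry, which has no successor, accounts for the
  -- extra one.
  crossing : ∀ u v y m →
    (∃ λ l₁ → ∃ λ p → ∃ λ q → ∃ λ l₂ → y ∷ m ≡ l₁ ++ p ∷ q ∷ l₂ × u ~ p × v ~ q)
    ⊎ nbrs u (y ∷ m) + nbrs v m ≤ suc (length m)
  crossing u v y [] = inj₂ (subst (_≤ 1) (sym (ℕ.+-identityʳ _)) (count-≤ (adj? G u) (y ∷ [])))
  crossing u v y (y′ ∷ m) with crossing u v y′ m
  ... | inj₁ (l₁ , p , q , l₂ , e , up , vq) = inj₁ (y ∷ l₁ , p , q , l₂ , cong (y ∷_) e , up , vq)
  ... | inj₂ le with adj? G u y | adj? G v y′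
  ... | yes uy | yes vy = inj₁ ([] , y , y′ , m , refl , uy , vy)
  ... | no _ | yes vy = inj₂ (subst (_≤ suc (suc (length m))) (sym (ℕ.+-suc _ _)) (s≤s le))
  ... | yes uy | no _ = inj₂ (s≤s le)
  ... | no _ | no _ = inj₂ (ℕ.m≤n⇒m≤1+n le)

  common : ∀ u v m → (∃ λ z → z ∈ m × u ~ z × v ~ z) ⊎ nbrs u m + nbrs v m ≤ length m
  common u v [] = inj₂ z≤n
  common u v (y ∷ m) with common u v m
  ... | inj₁ (z , i , e) = inj₁ (z , there i , e)
  ... | inj₂ le with adj? G u y | adj? G v y
  ... | yes uy | yes vy = inj₁ (y , here refl , uy , vy)
  ... | no _ | yes vy = inj₂ (subst (_≤ suc (length m)) (sym (ℕ.+-suc _ _)) (s≤s le))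
  ... | yes uy | no _ = inj₂ (s≤s le)
  ... | no _ | no _ = inj₂ (ℕ.m≤n⇒m≤1+n le)

  crossing′ : ∀ u v m →
    (∃ λ l₁ → ∃ λ p → ∃ λ q → ∃ λ l₂ → m ≡ l₁ ++ p ∷ q ∷ l₂ × u ~ p × v ~ q)
    ⊎ nbrs u m + nbrs v m ≤ suc (length m)
  crossing′ u v [] = inj₂ z≤n
  crossing′ u v (y ∷ m) with crossing u v y m
  ... | inj₁ c = inj₁ c
  ... | inj₂ le = inj₂ (linear _ _ 0 (le & count-∷≤ (adj? G v) y m)
    (lemma (nbrs u (y ∷ m)) (nbrs v (y ∷ m)) (length m) (nbrs v m)))
    where
    lemma : ∀ a b c d → a + b + (suc c + suc d) + 0 ≡ suc (suc c) + (a + d + b)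
    lemma = solve-∀

  -- Ore's argument: the ends of a nonadjacent Ore pair have a common neighbour
  -- outside the path joining them, or cross on that path.
  ore-pair : ∀ {u v m} → Unique (v ∷ m ++ ⟨ u ⟩) → ¬ u ~ v → n ≤ degree G u + degree G v →
    (∃ λ l₁ → ∃ λ p → ∃ λ q → ∃ λ l₂ → m ≡ l₁ ++ p ∷ q ∷ l₂ × u ~ p × v ~ q)
    ⊎ (∃ λ z → z ∉ v ∷ m ++ ⟨ u ⟩ × u ~ z × v ~ z)
  ore-pair {u} {v} {m} uniq ¬uv le with N , p ← outside uniq | crossing′ u v m
  ... | inj₁ c = inj₁ c
  ... | inj₂ le₁ with common u v N
  ... | inj₁ (z , i , e) = inj₂ (z , (λ j → unique-disjoint (v ∷ m ++ ⟨ u ⟩) (unique-resp-↭ p (allFin⁺ n)) j i) , e)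
  -- The path has `length m + 2` vertices and its ends contribute nothing to either degree, so the
  -- degree sum is at most `length m + 1 + length N`, which is n - 1.
  ... | inj₂ le₂ = ⊥-elim (ℕ.1+n≰n (begin
    suc n ≤⟨ s≤s le ⟩
    suc (degree G u + degree G v) ≡⟨ cong suc (cong₂ _+_ (degree-outside u (v ∷ m ++ ⟨ u ⟩) p) (degree-outside v (v ∷ m ++ ⟨ u ⟩) p)) ⟩
    suc (nbrs u (v ∷ m ++ ⟨ u ⟩) + nbrs u N + (nbrs v (v ∷ m ++ ⟨ u ⟩) + nbrs v N))
      ≡⟨ cong₂ (λ x y → suc (x + nbrs u N + (y + nbrs v N)))
           (trans (nbrs-∌ (m ++ ⟨ u ⟩) ¬uv) (trans (count-++ (adj? G u) m ⟨ u ⟩) (cong (nbrs u m +_) (nbrs-∌ [] ~-irrefl))))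
           (trans (nbrs-∌ (m ++ ⟨ u ⟩) ~-irrefl) (trans (count-++ (adj? G v) m ⟨ u ⟩) (cong (nbrs v m +_) (nbrs-∌ [] (¬uv ∘ ~-sym))))) ⟩
    suc (nbrs u m + 0 + nbrs u N + (nbrs v m + 0 + nbrs v N)) ≤⟨ linear _ _ 0 (le₁ & le₂) (lemma (nbrs u m) (nbrs u N) (nbrs v m) (nbrs v N) (length m) (length N)) ⟩
    suc (length m + 1) + length N ≡⟨ cong (λ k → suc k + length N) (length-++ m) ⟨
    length (v ∷ m ++ ⟨ u ⟩) + length N ≡⟨ length-outside (v ∷ m ++ ⟨ u ⟩) p ⟩
    n ∎))
    where
    open ℕ.≤-Reasoning
    lemma : ∀ a b c d e f → suc (a + 0 + b + (c + 0 + d)) + (suc e + f) + 0 ≡ suc (e + 1) + f + (a + c + (b + d))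
    lemma = solve-∀

  private
    Broken : List V → ℕ → Set
    Broken L k = ∃ λ u → ∃ λ v → ∃ λ m → Walk Ore v m u × (u ≢ v × n ≤ degree G u + degree G v)
      × ¬ u ~ v × L ↭ v ∷ m ++ ⟨ u ⟩ × suc (deficit v m u) ≡ k

    nonadjacent : ∀ {u v} → Ore u v → ¬ u ~ v → u ≢ v × n ≤ degree G u + degree G v
    nonadjacent (inj₁ e) ¬e = ⊥-elim (¬e e)
    nonadjacent (inj₂ q) ¬e = q

    -- The part up to `b` is known to consist of edges. At the first nonadjacent pair the cycle is
    -- rotated so that this pair closes it.
    scan : ∀ {a b} t l → Walk _~_ a t b → Walk Ore b l a →
      Walk _~_ a (t ++ b ∷ l) a ⊎ Broken (a ∷ t ++ b ∷ l) (deficit a (t ++ b ∷ l) a)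
    scan {a} {b} t [] v (edge r) with adj? G b a
    ... | yes e = inj₁ (v ⟫ edge e)
    ... | no ¬e = inj₂ (b , a , t , walk-map inj₁ v , nonadjacent r ¬e , ¬e , ↭-refl ,
      sym (trans (deficit-++ a t b [] a) (trans (cong (deficit a t b +_) (gap-¬adj ¬e)) (ℕ.+-comm _ 1))))
    scan {a} {b} t (c ∷ l) v (r ∷ w) with adj? G b c
    ... | yes e = subst (λ k → Walk _~_ a k a ⊎ Broken (a ∷ k) (deficit a k a)) (++-assoc t ⟨ b ⟩ (c ∷ l))
                    (scan (t ++ ⟨ b ⟩) l (v ⟫ edge e) w)
    ... | no ¬e = inj₂ (b , c , l ++ a ∷ t , w ⟫ walk-map inj₁ v , nonadjacent r ¬e , ¬e ,
      solve 5 (λ A B C L T → A ⊕ T ⊕ B ⊕ C ⊕ L ⊜ C ⊕ (L ⊕ A ⊕ T) ⊕ B) ↭-refl ⟨ a ⟩ ⟨ b ⟩ ⟨ c ⟩ l t ,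
      (begin
        suc (deficit c (l ++ a ∷ t) b) ≡⟨ cong suc (deficit-++ c l a t b) ⟩
        suc (deficit c l a + deficit a t b) ≡⟨ lemma _ _ ⟩
        deficit a t b + (1 + deficit c l a) ≡⟨ cong (λ k → deficit a t b + (k + deficit c l a)) (gap-¬adj ¬e) ⟨
        deficit a t b + (gap b c + deficit c l a) ≡⟨ deficit-++ a t b (c ∷ l) a ⟨
        deficit a (t ++ b ∷ c ∷ l) a ∎))
      where
      open ≡-Reasoning
      lemma : ∀ x y → suc (x + y) ≡ y + (1 + x)
      lemma = solve-∀

  broken : ∀ {a l} → IsCycle Ore a l → IsCycle _~_ a l ⊎ Broken (a ∷ l) (deficit a l a)
  broken {a} {x ∷ l} (cyc (r ∷ w) u le) = case adj? G a x of λ where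
    (no ¬e) → inj₂ (a , x , l , w , nonadjacent r ¬e , ¬e , ∷↭∷ʳ a (x ∷ l) ,
                    sym (cong (_+ deficit x l a) (gap-¬adj ¬e)))
    (yes e) → case scan [] l (edge e) w of λ where
      (inj₁ w′) → inj₁ (cyc w′ u le)
      (inj₂ b) → inj₂ b

  oreCycle-bound : ∀ {c} → (∀ {a l} → IsCycle _~_ a l → suc (length l) ≤ c) →
    ∀ {a l} → IsCycle Ore a l → suc (length l) ≤ c
  oreCycle-bound {c} bound C = go _ C ℕ.≤-refl
    where
    open ℕ.≤-Reasoning
    go : ∀ k {a l} → IsCycle Ore a l → deficit a l a ≤ k → suc (length l) ≤ c
    go k {a} {l} C d with broken C
    ... | inj₁ C′ = bound C′
    go zero C d | inj₂ (u , v , m , w , _ , _ , p , eq) with () ← ℕ.≤-trans (ℕ.≤-reflexive eq) d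
    go (suc k) {a} {l} C d | inj₂ (u , v , m , w , (u≢v , le) , ¬uv , p , eq)
      with uniq ← unique-resp-↭ p (IsCycle.unique C)
      with ore-pair uniq ¬uv le
    -- Inserting `z` between `u` and `v` gains a vertex and replaces the nonadjacent pair by two
    -- edges.
    ... | inj₂ (z , z∉ , uz , vz) = ℕ.≤-trans (ℕ.n≤1+n _) (subst (_≤ c) (sym (cong suc eqlen)) (go k
            (cyc (w ⟫ inj₁ uz ∷ edge (inj₁ (~-sym vz)))
              (unique-resp-↭ (solve 4 (λ Z V M U → Z ⊕ V ⊕ M ⊕ U ⊜ V ⊕ M ⊕ U ⊕ Z) ↭-refl ⟨ z ⟩ ⟨ v ⟩ m ⟨ u ⟩)
                (unique-∷ z∉ uniq))
              (subst (2 ≤_) eqlen (ℕ.m≤n⇒m≤1+n (IsCycle.long C))))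
            (ℕ.≤-pred (subst (_≤ suc k) (trans (sym eq) (cong suc (sym def))) d))))
      where
      eqlen : suc (length l) ≡ length (m ++ u ∷ z ∷ [])
      eqlen = trans (↭-length p) (trans (cong suc (length-++ m)) (trans (sym (ℕ.+-suc _ 1)) (sym (length-++ m))))
      def : deficit v (m ++ u ∷ z ∷ []) v ≡ deficit v m u
      def = trans (deficit-++ v m u _ v) (trans
        (cong (deficit v m u +_) (cong₂ _+_ (gap-adj uz) (gap-adj (~-sym vz)))) (ℕ.+-identityʳ _))
    -- The new cycle runs `v`, `l₁`, `x`, `u`, back along `l₂`, `y`, and home: the edges `xu` and
    -- `yv` replace the pairs `uv` and `xy`.
    ... | inj₁ (l₁ , x , y , l₂ , refl , ux , vy)
      with w₁ , _ ∷ w₂ ← walk-split l₁ w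
      = subst (_≤ c) (sym eqlen) (go k
            (cyc (w₁ ⟫ inj₁ (~-sym ux) ∷ (walk-reverse ore-sym w₂ ⟫ edge (inj₁ (~-sym vy))))
              (unique-resp-↭ perm uniq)
              (subst (2 ≤_) (ℕ.suc-injective eqlen) (IsCycle.long C)))
            (ℕ.≤-pred (ℕ.≤-trans (s≤s def) (subst (_≤ suc k) (sym eq) d))))
      where
      l′ = l₁ ++ x ∷ u ∷ reverse l₂ ++ ⟨ y ⟩
      perm : v ∷ (l₁ ++ x ∷ y ∷ l₂) ++ ⟨ u ⟩ ↭ v ∷ l′
      perm = ↭-trans (solve 6 (λ V L₁ X Y L₂ U → V ⊕ (L₁ ⊕ X ⊕ Y ⊕ L₂) ⊕ U ⊜ (V ⊕ L₁ ⊕ X ⊕ U ⊕ Y) ⊕ L₂)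
                        ↭-refl ⟨ v ⟩ l₁ ⟨ x ⟩ ⟨ y ⟩ l₂ ⟨ u ⟩)
             (↭-trans (++⁺ˡ (v ∷ l₁ ++ x ∷ u ∷ y ∷ []) (↭-sym (↭-reverse l₂)))
                      (solve 6 (λ V L₁ X Y L₂ U → (V ⊕ L₁ ⊕ X ⊕ U ⊕ Y) ⊕ L₂ ⊜ V ⊕ L₁ ⊕ X ⊕ U ⊕ L₂ ⊕ Y)
                        ↭-refl ⟨ v ⟩ l₁ ⟨ x ⟩ ⟨ y ⟩ (reverse l₂) ⟨ u ⟩))
      eqlen : suc (length l) ≡ suc (length l′)
      eqlen = ↭-length (↭-trans p perm)
      def : deficit v l′ v ≤ deficit v (l₁ ++ x ∷ y ∷ l₂) u
      def = begin
        deficit v l′ v ≡⟨ deficit-++ v l₁ x _ v ⟩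
        deficit v l₁ x + (gap x u + deficit u (reverse l₂ ++ ⟨ y ⟩) v)
          ≡⟨ cong (deficit v l₁ x +_) (cong₂ _+_ (gap-adj (~-sym ux)) (trans (deficit-++ u (reverse l₂) y [] v)
              (trans (cong₂ _+_ (deficit-reverse y l₂ u) (gap-adj (~-sym vy))) (ℕ.+-identityʳ _)))) ⟩
        deficit v l₁ x + deficit y l₂ u ≤⟨ ℕ.+-monoʳ-≤ (deficit v l₁ x) (ℕ.m≤n+m _ (gap x y)) ⟩
        deficit v l₁ x + (gap x y + deficit y l₂ u) ≡⟨ deficit-++ v l₁ x (y ∷ l₂) u ⟨
        deficit v (l₁ ++ x ∷ y ∷ l₂) u ∎

-- Detours and fans

module _ {n} (G : Graph (Fin n)) where

  private
    V = Fin n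
    _~_ = Adj G

  connected : 2 -Connected G → ∀ u v → Star _~_ u v
  connected (_ , conn) u v = gmap proj₁ id
    (conn ∅ (subst (_< 2) (sym (∣⊥∣≡0 n)) (s≤s z≤n)) (u , x∉p⇒x∈∁p ∉⊥) (v , x∉p⇒x∈∁p ∉⊥))

  connected-avoiding : 2 -Connected G → ∀ y {u v} → u ≢ y → v ≢ y →
    Star (λ a b → a ~ b × b ≢ y) u v
  connected-avoiding (_ , conn) y {u} {v} u≢y v≢y = gmap proj₁
    (λ {_} {b} e → e , λ { refl → x∈∁p⇒x∉p (proj₂ b) (x∈⁅x⁆ _) })
    (conn ⁅ y ⁆ (subst (_< 2) (sym (∣⁅x⁆∣≡1 y)) ℕ.≤-refl)
      (u , x∉p⇒x∈∁p (u≢y ∘ x∈⁅y⁆⇒x≡y y)) (v , x∉p⇒x∈∁p (v≢y ∘ x∈⁅y⁆⇒x≡y y)))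

  record Detour (y : V) (K Z : List V) : Set where
    constructor detour
    field
      {from to} : V
      {via} : List V
      from∈ : from ∈ K
      to∈ : to ∈ Z
      to≢ : to ≢ y
      walk : Walk _~_ from via to
      unique : Unique via
      avoids : All (λ x → x ∉ K × x ∉ Z × x ≢ y) via

  private
    -- Stops at the first vertex of `Z` and erases loops: if the start recurs further on, everything
    -- before its last occurrence is dropped.
    approach : ∀ {y Z x z} → Star (λ a b → a ~ b × b ≢ y) x z → z ∈ Z → x ∉ Z →
      ∃ λ r → ∃ λ z → Walk _~_ x r z × Unique (x ∷ r) × z ∈ Z × z ≢ y × All (λ w → w ∉ Z × w ≢ y) r
    approach ε z∈ x∉ = ⊥-elim (x∉ z∈)
    approach {y} {Z} {x} (_◅_ {j = w} (xw , w≢y) p) z∈ x∉ with w ∈? Z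
    ... | yes w∈ = [] , w , edge xw , [] ∷ [] , w∈ , w≢y , []
    ... | no w∉ with r , t , walk , u , t∈ , t≢y , av ← approach p z∈ w∉ with splitLast (_≟ x) (w ∷ r)
    ... | inj₁ none = w ∷ r , t , xw ∷ walk , unique-∷ (λ i → All.lookup none i refl) u , t∈ , t≢y , (w∉ , w≢y) ∷ av
    ... | inj₂ (ys , .x , zs , eq , refl , none) = zs , t ,
      proj₂ (walk-split ys (subst (λ l → Walk _~_ x l t) eq (xw ∷ walk))) ,
      unique-∷ (λ i → All.lookup none i refl) (AllPairs.tail (unique-++ʳ ys (subst Unique eq u))) ,
      t∈ , t≢y , All.tail (All.++⁻ʳ ys (subst (All _) eq ((w∉ , w≢y) ∷ av)))

  -- Starting from the last visit to `K` keeps the inner vertices off `K` too.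
  exit : 2 -Connected G → ∀ y {K Z k z} → k ∈ K → k ∉ Z → k ≢ y → z ∈ Z → z ≢ y → Detour y K Z
  exit conn y {K} {Z} k∈ k∉ k≢y z∈ z≢y
    with r , t , walk , u , t∈ , t≢y , av ← approach (connected-avoiding conn y k≢y z≢y) z∈ k∉
    with splitLast (_∈? K) r
  ... | inj₁ none = detour k∈ t∈ t≢y walk (AllPairs.tail u) (All.zip (none , av))
  ... | inj₂ (ys , x , zs , refl , x∈ , none) = detour x∈ t∈ t≢y (proj₂ (walk-split ys walk))
      (AllPairs.tail (unique-++ʳ ys (AllPairs.tail u))) (All.zip (none , All.tail (All.++⁻ʳ ys av)))

  record Fan (C : List V) (v : V) : Set where
    constructor fan
    field
      {u₁ u₂} : V
      L R : List V
      walkL : Walk _~_ v L u₁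
      walkR : Walk _~_ v R u₂
      u₁∈ : u₁ ∈ C
      u₂∈ : u₂ ∈ C
      u₁≢u₂ : u₁ ≢ u₂
      unique : Unique (C ++ v ∷ L ++ R)

  swap-fan : ∀ {C v} → Fan C v → Fan C v
  swap-fan {C} {v} (fan L R wL wR ∈₁ ∈₂ ne u) = fan R L wR wL ∈₂ ∈₁ (ne ∘ sym)
    (unique-resp-↭ (solve 4 (λ C V L R → C ⊕ V ⊕ L ⊕ R ⊜ C ⊕ V ⊕ R ⊕ L) ↭-refl C ⟨ v ⟩ L R) u)

  private
    pass : ∀ {C x y} (F : Fan C y) → x ~ y → x ∈ Fan.L F → Fan C x
    pass {C} {x} {y} (fan L R wL wR ∈₁ ∈₂ ne u) xy x∈ with La , Lb , refl ← ∈-∃++ x∈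
      = fan Lb (y ∷ R) (proj₂ (walk-split La wL)) (xy ∷ wR) ∈₁ ∈₂ ne
        (unique-⊑ La u (solve 6 (λ C Y La X Lb R → C ⊕ Y ⊕ (La ⊕ X ⊕ Lb) ⊕ R ⊜ (C ⊕ X ⊕ Lb ⊕ Y ⊕ R) ⊕ La)
          ↭-refl C ⟨ y ⟩ La ⟨ x ⟩ Lb R))

    graft : ∀ {C x y r z} (F : Fan C y) → x ~ y → Walk _~_ x r z →
      Unique (x ∷ r ++ C ++ y ∷ Fan.L F ++ Fan.R F) →
      (z ∈ C × z ≢ Fan.u₂ F) ⊎ z ∈ Fan.L F → Fan C x
    graft {C} {x} {y} {r} (fan L R wL wR ∈₁ ∈₂ ne _) xy w u (inj₁ (z∈ , z≢)) =
      fan r (y ∷ R) w (xy ∷ wR) z∈ ∈₂ z≢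
        (unique-⊑ L u (solve 6 (λ C Y L X S R → X ⊕ S ⊕ C ⊕ Y ⊕ L ⊕ R ⊜ (C ⊕ X ⊕ S ⊕ Y ⊕ R) ⊕ L)
          ↭-refl C ⟨ y ⟩ L ⟨ x ⟩ r R))
    graft {C} {x} {y} {r} {z} (fan L R wL wR ∈₁ ∈₂ ne _) xy w u (inj₂ z∈) with La , Lb , refl ← ∈-∃++ z∈
      = fan (r ++ z ∷ Lb) (y ∷ R) (w ⟫ proj₂ (walk-split La wL)) (xy ∷ wR) ∈₁ ∈₂ ne
        (unique-⊑ La u (solve 8 (λ C Y La Lb X S R Z → X ⊕ S ⊕ C ⊕ Y ⊕ (La ⊕ Z ⊕ Lb) ⊕ R ⊜ (C ⊕ X ⊕ (S ⊕ Z ⊕ Lb) ⊕ Y ⊕ R) ⊕ La)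
          ↭-refl C ⟨ y ⟩ La Lb ⟨ x ⟩ r R ⟨ z ⟩))

    graft-swapped : ∀ {C x y r z} (F : Fan C y) → x ~ y → Walk _~_ x r z →
      Unique (x ∷ r ++ C ++ y ∷ Fan.L F ++ Fan.R F) →
      (z ∈ C × z ≢ Fan.u₁ F) ⊎ z ∈ Fan.R F → Fan C x
    graft-swapped {C} {x} {y} {r} F xy w u = graft (swap-fan F) xy w
      (unique-resp-↭ (solve 6 (λ X S C Y L R → X ⊕ S ⊕ C ⊕ Y ⊕ L ⊕ R ⊜ X ⊕ S ⊕ C ⊕ Y ⊕ R ⊕ L)
        ↭-refl ⟨ x ⟩ r C ⟨ y ⟩ (Fan.L F) (Fan.R F)) u)

  -- The two-path case of the fan lemma, by Whitney's induction along a path to `C`. A fan at the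
  -- neighbour `y` is handed on to `x`: one arm is prolonged by the edge `xy`, the other is replaced
  -- by a detour from `x` that avoids `y`, unless `x` already lies on an arm.
  fan-exists : 2 -Connected G → ∀ {C p q} → Unique C → p ∈ C → q ∈ C → p ≢ q → ∀ v → v ∉ C → Fan C v
  fan-exists conn {C} {p} {q} uC p∈ q∈ p≢q v = go (connected conn v p)
    where
    other : ∀ y → ∃ λ z → z ∈ C × z ≢ y
    other y with p ≟ y
    ... | yes refl = q , q∈ , p≢q ∘ sym
    ... | no ne = p , p∈ , ne
    go : ∀ {x} → Star _~_ x p → x ∉ C → Fan C x
    go ε x∉ = ⊥-elim (x∉ p∈)
    go {x} (_◅_ {j = y} xy path) x∉ with y ∈? C
    ... | yes y∈ with z , z∈ , z≢y ← other y
      with detour {to = t} {via = r} (here refl) t∈ t≢y w u av ←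
             exit conn y {K = ⟨ x ⟩} (here refl) x∉ (λ { refl → x∉ y∈ }) z∈ z≢y
      = fan [] r (edge xy) w y∈ t∈ (t≢y ∘ sym)
          (unique-++ uC (unique-∷ (λ i → proj₁ (All.lookup av i) (here refl)) u)
            λ { i (here refl) → x∉ i ; i (there j) → proj₁ (proj₂ (All.lookup av j)) i })
    ... | no y∉ with F ← go path y∉ with x ∈? Fan.L F | x ∈? Fan.R F
    ... | yes x∈L | _ = pass F xy x∈L
    ... | no _ | yes x∈R = pass (swap-fan F) xy x∈R
    ... | no x∉L | no x∉R
      with detour {to = t} {via = r} (here refl) t∈ t≢y w u av ←
             exit conn y {K = ⟨ x ⟩} {Z = C ++ Fan.L F ++ Fan.R F} (here refl)
               (λ i → [ x∉ , (λ j → [ x∉L , x∉R ]′ (∈-++⁻ (Fan.L F) j)) ]′ (∈-++⁻ C i))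
               (λ { refl → ~-irrefl G xy }) (∈-++⁺ˡ p∈) (λ { refl → y∉ p∈ })
      = case ∈-++⁻ C t∈ of λ where
          (inj₁ t∈C) → case t ≟ Fan.u₂ F of λ where
            -- A detour that ends where the arm `R` ends must replace `R`, so that the two ends stay
            -- distinct.
            (yes refl) → graft-swapped F xy w uniq (inj₁ (t∈C , Fan.u₁≢u₂ F ∘ sym))
            (no t≢) → graft F xy w uniq (inj₁ (t∈C , t≢))
          (inj₂ t∈LR) → case ∈-++⁻ (Fan.L F) t∈LR of λ where
            (inj₁ t∈L) → graft F xy w uniq (inj₂ t∈L)
            (inj₂ t∈R) → graft-swapped F xy w uniq (inj₂ t∈R)
      where
      x∉Z : x ∉ C ++ y ∷ Fan.L F ++ Fan.R F
      x∉Z i with ∈-++⁻ C i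
      ... | inj₁ j = x∉ j
      ... | inj₂ (here refl) = ~-irrefl G xy
      ... | inj₂ (there j) = [ x∉L , x∉R ]′ (∈-++⁻ (Fan.L F) j)
      r∉Z : ∀ {s} → s ∈ r → s ∉ C ++ y ∷ Fan.L F ++ Fan.R F
      r∉Z i j with _ , s∉ , s≢y ← All.lookup av i with ∈-++⁻ C j
      ... | inj₁ k = s∉ (∈-++⁺ˡ k)
      ... | inj₂ (here refl) = s≢y refl
      ... | inj₂ (there k) = s∉ (∈-++⁺ʳ C k)
      uniq : Unique (x ∷ r ++ C ++ y ∷ Fan.L F ++ Fan.R F)
      uniq = unique-∷ (λ i → [ (λ j → proj₁ (All.lookup av j) (here refl)) , x∉Z ]′ (∈-++⁻ r i))
               (unique-++ u (Fan.unique F) r∉Z)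

-- Segments of the cycle between attachments

-- The vertex next to the centre of the fan; on an arm that is a single edge, its end on the cycle
-- takes this role.
head : ∀ {A : Set} → List A → A → A
head [] u = u
head (x ∷ _) u = x

module _ {n} (G : Graph (Fin n)) where

  private
    V = Fin n
    _~_ = Adj G
    O = Ore G

  Far : V → V → Set
  Far u w = u ≢ w × ¬ O u w

  far-sym : ∀ {u w} → Far u w → Far w u
  far-sym (ne , ¬o) = ne ∘ sym , ¬o ∘ ore-sym G

  -- No induced K₁,₄ centred at v without an Ore pair.
  NoFarClaw : V → Set
  NoFarClaw v = ∀ {a b c d} → v ~ a → v ~ b → v ~ c → v ~ d →
    Far a b → Far a c → Far a d → Far b c → Far b d → Far c d → ⊥

  Arm : V → List V → V → Set
  Arm v [] u = v ~ u
  Arm v (x ∷ l) u = v ~ x × Walk O x l u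

  arm-head : ∀ {v u} l → Arm v l u → v ~ head l u
  arm-head [] e = e
  arm-head (x ∷ l) (e , _) = e

  arm-hop : ∀ {v u w} l → Arm v l u → O w (head l u) → Walk O w l u
  arm-hop [] _ o = edge o
  arm-hop (x ∷ l) (_ , w) o = o ∷ w

  arm-walk : ∀ {v u} l → Arm v l u → Walk O v l u
  arm-walk l a = arm-hop l a (inj₁ (arm-head l a))

  walk-arm : ∀ {v u l} → Walk _~_ v l u → Arm v l u
  walk-arm (edge e) = e
  walk-arm (e ∷ w) = e , walk-map inj₁ w

  arm-++ : ∀ {v x u} l {m} → Arm v l x → Walk O x m u → Arm v (l ++ x ∷ m) u
  arm-++ [] e w = e , w
  arm-++ (y ∷ l) (e , w′) w = e , (w′ ⟫ w)

  arm-drop : ∀ {v u z} l {m} → Arm v (l ++ z ∷ m) u → Walk O z m u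
  arm-drop [] (_ , w) = w
  arm-drop (x ∷ l) (_ , w) = proj₂ (walk-split l w)

  -- Back along one arm from an inner vertex z, across the Ore pair of first vertices,
  -- and out along the other arm; the centre is left out.
  turn-around : ∀ {v u₁ u₂ z} l {m} R → Arm v (l ++ z ∷ m) u₁ → Arm v R u₂ →
    O (head (l ++ z ∷ m) u₁) (head R u₂) → Walk O z (reverse l ++ R) u₂
  turn-around [] R _ aR o = arm-hop R aR o
  turn-around {u₂ = u₂} {z} (x ∷ l) R (_ , w) aR o =
    subst (λ k → Walk O z k u₂) (trans (sym (++-assoc (reverse l) ⟨ x ⟩ R)) (cong (_++ R) (sym (unfold-reverse x l))))
      (walk-reverse (ore-sym G) (proj₁ (walk-split l w)) ⟫ arm-hop R aR o)

  split-cycle : ∀ {a l u₁ u₂} → Walk _~_ a l a → u₁ ∈ a ∷ l → u₂ ∈ a ∷ l → u₁ ≢ u₂ →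
    ∃ λ s → ∃ λ t → Walk _~_ u₁ s u₂ × Walk _~_ u₂ t u₁ × a ∷ l ↭ u₁ ∷ s ++ u₂ ∷ t
  split-cycle {a} w (here refl) (here refl) ne = ⊥-elim (ne refl)
  split-cycle {a} w (here refl) (there j) ne with s , t , refl ← ∈-∃++ j
    with w₁ , w₂ ← walk-split s w = s , t , w₁ , w₂ , ↭-refl
  split-cycle {a} {l} {u₁} {u₂} w (there i) j ne with l₁ , l₂ , refl ← ∈-∃++ i
    with w₁ , w₂ ← walk-split l₁ w
    with perm ← solve 4 (λ A L₁ U L₂ → A ⊕ L₁ ⊕ U ⊕ L₂ ⊜ U ⊕ L₂ ⊕ A ⊕ L₁) ↭-refl ⟨ a ⟩ l₁ ⟨ u₁ ⟩ l₂
    with ∈-resp-↭ perm j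
  ... | here refl = ⊥-elim (ne refl)
  ... | there k with s , t , eq ← ∈-∃++ k
    with w₃ , w₄ ← walk-split s (subst (λ m → Walk _~_ u₁ m u₁) eq (w₂ ⟫ w₁))
    = s , t , w₃ , w₄ , ↭-trans perm (↭-reflexive (cong (u₁ ∷_) eq))

  module Segments {c} (bound : ∀ {a l} → IsCycle G O a l → suc (length l) ≤ c) where

    -- The neighbours of `v` cut `s` into gaps. Bypassing the first gap over `L`, the last over `R`,
    -- or an inner one through `v` alone cannot lengthen the cycle, so these gaps have at least
    -- `length L + 1`, `length R + 1` and 1 vertices. Without neighbours on `s` the whole of it is
    -- bypassed over both arms.
    segment : ∀ {v u₁ u₂} L R s t → Arm v L u₁ → Arm v R u₂ → Walk O u₁ s u₂ → Walk O u₂ t u₁ →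
      Unique (u₁ ∷ s ++ u₂ ∷ t ++ v ∷ L ++ R) → 2 + length s + length t ≡ c →
      suc (length L + length R) + 2 * nbrs G v s ≤ length s
    segment {v} {u₁} {u₂} L R s t aL aR w wt u eq = initial [] s refl
      where
      replace : ∀ {q} → Walk O u₁ q u₂ → 1 ≤ length q → Unique (u₁ ∷ q ++ u₂ ∷ t) → length q ≤ length s
      replace {q} wq 1≤ uq = linear _ _ 0
        (subst₂ _≤_ (cong suc (length-++ q)) (sym eq)
          (bound (cyc (wq ⟫ wt) uq (subst (2 ≤_) (sym (length-++ q)) (1≤ & s≤s z≤n)))))
        (lemma (length q) (length s) (length t))
        where
        lemma : ∀ q s t → q + (2 + s + t) + 0 ≡ s + suc (q + suc t)
        lemma = solve-∀

      nb = nbrs G v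
      nonempty : ∀ (pre : List V) {x l} → 1 ≤ length (pre ++ x ∷ l)
      nonempty [] = s≤s z≤n
      nonempty (_ ∷ _) = s≤s z≤n

      -- `x` is the latest neighbour of `v` met on `s`, `X` what has been scanned since, `M` what is
      -- still to come.
      later : ∀ pre x X M → s ≡ pre ++ x ∷ X ++ M → v ~ x →
        suc (length R) + 2 * nb M ≤ length X + length M
      later pre x X [] refl e = linear _ _ 0
          (subst₂ _≤_ (length-++ pre) (trans (length-++ pre) (cong (λ k → length pre + suc k) (length-++ X)))
            (replace (proj₁ (walk-split pre w) ⟫ inj₁ (~-sym G e) ∷ arm-walk R aR) (nonempty pre)
              (unique-⊑ (X ++ L) u
                (solve 9 (λ U₁ P X′ X U₂ T V L R → U₁ ⊕ (P ⊕ X′ ⊕ X) ⊕ U₂ ⊕ T ⊕ V ⊕ L ⊕ R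
                  ⊜ (U₁ ⊕ (P ⊕ X′ ⊕ V ⊕ R) ⊕ U₂ ⊕ T) ⊕ X ⊕ L)
                  ↭-refl ⟨ u₁ ⟩ pre ⟨ x ⟩ (X ++ []) ⟨ u₂ ⟩ t ⟨ v ⟩ L R
                 ▹ ++⁺ˡ (u₁ ∷ (pre ++ x ∷ v ∷ R) ++ u₂ ∷ t) (++⁺ʳ L (↭-reflexive (++-identityʳ X)))))))
          (lemma (length R) (length X) (length pre))
        where
        lemma : ∀ r x p → suc r + 0 + (p + suc (x + 0)) + 0 ≡ x + 0 + (p + suc (suc r))
        lemma = solve-∀
      later pre x X (m ∷ M) refl e = case adj? G v m of λ where
          (no ¬f) → subst₂ (λ a b → suc (length R) + 2 * a ≤ b) (sym (nbrs-∌ G M ¬f))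
            (trans (cong (_+ length M) (length-++ X)) (ℕ.+-assoc (length X) 1 _))
            (later pre x (X ++ ⟨ m ⟩) M (cong (λ k → pre ++ x ∷ k) (sym (++-assoc X ⟨ m ⟩ M))) e)
          (yes f) → subst (λ a → suc (length R) + 2 * a ≤ length X + suc (length M)) (sym (count-accept (adj? G v) f))
            (linear _ _ 0
              (later (pre ++ x ∷ X) m [] M (sym (++-assoc pre (x ∷ X) (m ∷ M))) f
              & subst₂ _≤_ (length-++ pre) (trans (length-++ pre) (cong (λ k → length pre + suc k) (length-++ X)))
                (replace (proj₁ (walk-split pre w) ⟫ inj₁ (~-sym G e) ∷ inj₁ f ∷
                    proj₂ (walk-split X (proj₂ (walk-split pre w)))) (nonempty pre)
                  (unique-⊑ (X ++ L ++ R) u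
                    (solve 11 (λ U₁ P X′ X U₂ T V L R M N → U₁ ⊕ (P ⊕ X′ ⊕ X ⊕ M ⊕ N) ⊕ U₂ ⊕ T ⊕ V ⊕ L ⊕ R
                      ⊜ (U₁ ⊕ (P ⊕ X′ ⊕ V ⊕ M ⊕ N) ⊕ U₂ ⊕ T) ⊕ X ⊕ L ⊕ R)
                      ↭-refl ⟨ u₁ ⟩ pre ⟨ x ⟩ X ⟨ u₂ ⟩ t ⟨ v ⟩ L R ⟨ m ⟩ M))))
              (lemma (length R) (length X) (length pre) (length M) (nb M)))
        where
        lemma : ∀ r x p m k → suc r + 2 * suc k + (m + (p + suc (x + suc m))) + 0
          ≡ x + suc m + (suc r + 2 * k + (p + suc (suc (suc m))))
        lemma = solve-∀

      initial : ∀ X M → s ≡ X ++ M →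
        suc (length L + length R) + 2 * nb M ≤ length X + length M
      initial X [] refl = linear _ _ 0
          (subst₂ _≤_ (trans (length-++ (reverse L)) (cong (_+ suc (length R)) (length-reverse L))) (length-++ X)
            (replace (walk-reverse (ore-sym G) (arm-walk L aL) ⟫ arm-walk R aR) (nonempty (reverse L))
              (unique-⊑ (X ++ []) u
                (solve 7 (λ U₁ X U₂ T V L R → U₁ ⊕ X ⊕ U₂ ⊕ T ⊕ V ⊕ L ⊕ R ⊜ L ⊕ U₁ ⊕ V ⊕ R ⊕ U₂ ⊕ T ⊕ X)
                  ↭-refl ⟨ u₁ ⟩ (X ++ []) ⟨ u₂ ⟩ t ⟨ v ⟩ L R
                 ▹ ++⁺ʳ _ (↭-sym (↭-reverse L))
                 ▹ solve 7 (λ U₁ X U₂ T V L R → L ⊕ U₁ ⊕ V ⊕ R ⊕ U₂ ⊕ T ⊕ X ⊜ (U₁ ⊕ (L ⊕ V ⊕ R) ⊕ U₂ ⊕ T) ⊕ X)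
                  ↭-refl ⟨ u₁ ⟩ (X ++ []) ⟨ u₂ ⟩ t ⟨ v ⟩ (reverse L) R))))
          (lemma (length L) (length R) (length X))
        where
        lemma : ∀ l r x → suc (l + r) + 0 + (x + 0) + 0 ≡ x + 0 + (l + suc r)
        lemma = solve-∀
      initial X (m ∷ M) refl = case adj? G v m of λ where
          (no ¬f) → subst₂ (λ a b → suc (length L + length R) + 2 * a ≤ b) (sym (nbrs-∌ G M ¬f))
            (trans (cong (_+ length M) (length-++ X)) (ℕ.+-assoc (length X) 1 _))
            (initial (X ++ ⟨ m ⟩) M (sym (++-assoc X ⟨ m ⟩ M)))
          (yes f) → subst (λ a → suc (length L + length R) + 2 * a ≤ length X + suc (length M)) (sym (count-accept (adj? G v) f))
            (linear _ _ 0
              (later X m [] M refl f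
              & subst₂ _≤_ (trans (length-++ (reverse L)) (cong (_+ suc (suc (length M))) (length-reverse L))) (length-++ X)
                (replace (walk-reverse (ore-sym G) (arm-walk L aL) ⟫ inj₁ f ∷ proj₂ (walk-split X w)) (nonempty (reverse L))
                  (unique-⊑ (X ++ R) u
                    (solve 9 (λ U₁ X U₂ T V L R M N → U₁ ⊕ (X ⊕ M ⊕ N) ⊕ U₂ ⊕ T ⊕ V ⊕ L ⊕ R ⊜ L ⊕ U₁ ⊕ V ⊕ M ⊕ N ⊕ U₂ ⊕ T ⊕ X ⊕ R)
                      ↭-refl ⟨ u₁ ⟩ X ⟨ u₂ ⟩ t ⟨ v ⟩ L R ⟨ m ⟩ M
                     ▹ ++⁺ʳ _ (↭-sym (↭-reverse L))
                     ▹ solve 9 (λ U₁ X U₂ T V L R M N → L ⊕ U₁ ⊕ V ⊕ M ⊕ N ⊕ U₂ ⊕ T ⊕ X ⊕ R ⊜ (U₁ ⊕ (L ⊕ V ⊕ M ⊕ N) ⊕ U₂ ⊕ T) ⊕ X ⊕ R)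
                      ↭-refl ⟨ u₁ ⟩ X ⟨ u₂ ⟩ t ⟨ v ⟩ (reverse L) R ⟨ m ⟩ M))))
              (lemma (length L) (length R) (length X) (length M) (nb M)))
        where
        lemma : ∀ l r x m k → suc (l + r) + 2 * suc k + (m + (x + suc m)) + 0
          ≡ x + suc m + (suc r + 2 * k + (l + suc (suc m)))
        lemma = solve-∀

-- The neighbours missed by a longest fan

module Missing {n} (G : Graph (Fin n)) where

  private
    V = Fin n
    _~_ = Adj G
    O = Ore G

  record OreFan (C : List V) (v : V) : Set where
    constructor oreFan
    field
      {u₁ u₂} : V
      L R : List V
      armL : Arm G v L u₁
      armR : Arm G v R u₂
      u₁∈ : u₁ ∈ C
      u₂∈ : u₂ ∈ C
      u₁≢u₂ : u₁ ≢ u₂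
      unique : Unique (C ++ v ∷ L ++ R)

    size : ℕ
    size = length L + length R

    head₁ head₂ : V
    head₁ = head L u₁
    head₂ = head R u₂

  open OreFan using (size)

  fan⇒oreFan : ∀ {C v} → Fan G C v → OreFan C v
  fan⇒oreFan (fan L R wL wR ∈₁ ∈₂ ne u) = oreFan L R (walk-arm G wL) (walk-arm G wR) ∈₁ ∈₂ ne u

  swap-oreFan : ∀ {C v} → OreFan C v → OreFan C v
  swap-oreFan {C} {v} (oreFan L R aL aR ∈₁ ∈₂ ne u) = oreFan R L aR aL ∈₂ ∈₁ (ne ∘ sym)
    (unique-resp-↭ (solve 4 (λ C V L R → C ⊕ V ⊕ L ⊕ R ⊜ C ⊕ V ⊕ R ⊕ L) ↭-refl C ⟨ v ⟩ L R) u)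

  non : V → List V → ℕ
  non v = count (λ u → ¬? (adj? G v u))

  nbrs+non : ∀ v l → nbrs G v l + non v l ≡ length l
  nbrs+non v [] = refl
  nbrs+non v (x ∷ l) with adj? G v x
  ... | yes _ = cong suc (nbrs+non v l)
  ... | no _ = trans (ℕ.+-suc _ _) (cong suc (nbrs+non v l))

  module LongestCycle {c₀ : V} {cs : List V} (cycle : IsCycle G _~_ c₀ cs)
           (longest : ∀ {a l} → IsCycle G _~_ a l → length l ≤ length cs)
           {v : V} (heavy : HeavyVertex G v) where

    private
      C = c₀ ∷ cs

    open Segments G {c = length C} (oreCycle-bound G (s≤s ∘ longest))

    -- The sum of `segment` over both sides. The ends `u₁`, `u₂` may be two further neighbours, at a
    -- cost of 4; the two ends as vertices of `C` and the summand 1 of each segment pay for it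
    -- exactly.
    cycle-length : (F : OreFan C v) → 2 * size F + 2 * nbrs G v C ≤ length C
    cycle-length (oreFan {u₁} {u₂} L R aL aR ∈₁ ∈₂ ne u)
      with s , t , ws , wt , p ← split-cycle G (IsCycle.walk cycle) ∈₁ ∈₂ ne
      = linear _ _ 0
          (segment L R s t aL aR (walk-map inj₁ ws) (walk-map inj₁ wt)
            (unique-resp-↭ (++⁺ʳ _ p ▹ assoc L R) u) len
          & segment R L t s aR aL (walk-map inj₁ wt) (walk-map inj₁ ws)
            (unique-resp-↭ (++⁺ʳ _ p ▹ assoc L R ▹ exchange) u)
            (trans (cong (2 +_) (ℕ.+-comm (length t) (length s))) len)
          & ℕ.*-monoʳ-≤ 2 nb≤ & ℕ.≤-reflexive len)
          (lemma (length L) (length R) (length s) (length t) (nbrs G v s) (nbrs G v t) (nbrs G v C) (length C))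
      where
      assoc : ∀ L R → (u₁ ∷ s ++ u₂ ∷ t) ++ v ∷ L ++ R ↭ u₁ ∷ s ++ u₂ ∷ t ++ v ∷ L ++ R
      assoc L R = ↭-reflexive (cong (u₁ ∷_) (++-assoc s (u₂ ∷ t) (v ∷ L ++ R)))
      exchange : u₁ ∷ s ++ u₂ ∷ t ++ v ∷ L ++ R ↭ u₂ ∷ t ++ u₁ ∷ s ++ v ∷ R ++ L
      exchange = solve 7 (λ A S B T V L R → A ⊕ S ⊕ B ⊕ T ⊕ V ⊕ L ⊕ R ⊜ B ⊕ T ⊕ A ⊕ S ⊕ V ⊕ R ⊕ L)
                   ↭-refl ⟨ u₁ ⟩ s ⟨ u₂ ⟩ t ⟨ v ⟩ L R
      len : 2 + length s + length t ≡ length C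
      len = sym (trans (↭-length p) (trans (cong suc (trans (length-++ s) (ℕ.+-suc _ _))) refl))
      nb≤ : nbrs G v C ≤ 2 + nbrs G v s + nbrs G v t
      nb≤ = begin
        nbrs G v C ≡⟨ count-↭ (adj? G v) p ⟩
        nbrs G v (u₁ ∷ s ++ u₂ ∷ t) ≤⟨ count-∷≤ (adj? G v) u₁ (s ++ u₂ ∷ t) ⟩
        suc (nbrs G v (s ++ u₂ ∷ t)) ≡⟨ cong suc (count-++ (adj? G v) s (u₂ ∷ t)) ⟩
        suc (nbrs G v s + nbrs G v (u₂ ∷ t)) ≤⟨ s≤s (ℕ.+-monoʳ-≤ (nbrs G v s) (count-∷≤ (adj? G v) u₂ t)) ⟩
        suc (nbrs G v s + suc (nbrs G v t)) ≡⟨ cong suc (ℕ.+-suc _ _) ⟩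
        2 + nbrs G v s + nbrs G v t ∎
        where open ℕ.≤-Reasoning
      lemma : ∀ l r s t a b k c →
        2 * (l + r) + 2 * k + (s + (t + (2 * (2 + a + b) + c))) + 0
        ≡ c + (suc (l + r) + 2 * a + (suc (r + l) + 2 * b + (2 * k + (2 + s + t))))
      lemma = solve-∀

    module _ (F : OreFan C v) where

      open OreFan F hiding (size)
      private
        M = C ++ v ∷ L ++ R
        N = proj₁ (outside G unique)
        M++N = proj₂ (outside G unique)

      missed : List V
      missed = filter (adj? G v) N

      missed-adj : ∀ {a} → a ∈ missed → v ~ a
      missed-adj i = proj₂ (∈-filter⁻ (adj? G v) {xs = N} i)

      missed-∉ : ∀ {a} → a ∈ missed → a ∉ M
      missed-∉ i j = unique-disjoint M (unique-resp-↭ M++N (allFin⁺ n)) j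
        (proj₁ (∈-filter⁻ (adj? G v) {xs = N} i))

      missed-unique : Unique missed
      missed-unique = Unique.filter⁺ (adj? G v) (unique-++ʳ M (unique-resp-↭ M++N (allFin⁺ n)))

      -- Split `n ≤ 2 * degree G v` over `C`, the arms and the rest. `cycle-length` cancels the
      -- neighbours on `C`; what remains is three times `size F` minus twice the neighbours on the
      -- arms, that is, `size F` plus twice the non-neighbours.
      missed-large : suc (size F + 2 * (non v L + non v R)) ≤ length missed
      missed-large = linear _ _ 0
        (heavy & ℕ.≤-reflexive deg
         & ℕ.+-monoʳ-≤ (length M) (count-≤ (adj? G v) N) & ℕ.≤-reflexive (length-outside G M M++N)
         & ℕ.≤-reflexive lenM & cycle-length F
         & ℕ.*-monoʳ-≤ 2 (ℕ.≤-reflexive (nbrs+non v L)) & ℕ.*-monoʳ-≤ 2 (ℕ.≤-reflexive (nbrs+non v R)))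
        (lemma (degree G v) n (nbrs G v C) (nbrs G v L) (nbrs G v R) (non v L) (non v R)
          (length missed) (length M) (length N) (length C) (length L) (length R))
        where
        lemma : ∀ d n kC kL kR xL xR A M N C l r →
          suc (l + r + 2 * (xL + xR)) + (2 * d + (2 * (kC + (kL + kR) + A) + (M + N + (n + (M + (C + (2 * l + 2 * r))))))) + 0
          ≡ A + (n + (2 * d + (M + A + (M + N + (C + suc (l + r) + (2 * (l + r) + 2 * kC + (2 * (kL + xL) + 2 * (kR + xR))))))))
        lemma = solve-∀
        deg : 2 * degree G v ≡ 2 * (nbrs G v C + (nbrs G v L + nbrs G v R) + length missed)
        deg = cong (2 *_) (trans (degree-outside G v M M++N) (cong (_+ length missed)
          (trans (count-++ (adj? G v) C (v ∷ L ++ R)) (cong (nbrs G v C +_)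
            (trans (nbrs-∌ G (L ++ R) (~-irrefl G)) (count-++ (adj? G v) L R))))))
        lenM : length C + suc (length L + length R) ≡ length M
        lenM = sym (trans (length-++ C) (cong (λ k → length C + suc k) (length-++ L)))

    prefix-nbr : ∀ {w u} l {m} → Arm G w (l ++ m) u → All (¬_ ∘ (w ~_)) l → length l ≡ 0
    prefix-nbr [] _ _ = refl
    prefix-nbr (x ∷ l) (e , _) (¬e ∷ _) = ⊥-elim (¬e e)

    -- `X` takes over from `L`, continuing along `L` if it ends there, and maximality bounds it by
    -- the discarded part. If the heads form an Ore pair, most of that part returns in the other
    -- arm: enter it at the last neighbour of `v`, run back to the head and cross to `R`. Only the
    -- stretch beyond that neighbour is lost, and it consists of non-neighbours.
    insertion : ∀ (F : OreFan C v) → (∀ (F′ : OreFan C v) → size F′ ≤ size F) → ∀ {z} X → Arm G v X z →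
      Unique (X ++ C ++ v ∷ OreFan.L F ++ OreFan.R F) →
      (z ∈ C × z ≢ OreFan.u₂ F) ⊎ z ∈ OreFan.L F →
      length X ≤ length (OreFan.L F) ×
      (O (OreFan.head₁ F) (OreFan.head₂ F) → length X ≤ non v (OreFan.L F))
    insertion F@(oreFan {u₁} {u₂} L R aL aR ∈₁ ∈₂ ne u) max {z} X aX uX = λ where
        (inj₁ (z∈ , z≢)) → cut L [] X (sym (++-identityʳ L)) aX z∈ z≢ (sym (ℕ.+-identityʳ _))
          (unique-resp-↭ (solve 5 (λ X C V L R → X ⊕ C ⊕ V ⊕ L ⊕ R ⊜ C ⊕ V ⊕ X ⊕ L ⊕ R) ↭-refl X C ⟨ v ⟩ L R) uX)
        (inj₂ z∈) → case ∈-∃++ z∈ of λ where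
          (La , Lb , refl) → cut La (z ∷ Lb) (X ++ z ∷ Lb) refl (arm-++ G X aX (arm-drop G La aL)) ∈₁ ne (length-++ X)
            (unique-resp-↭ (solve 7 (λ X C V La Z Lb R → X ⊕ C ⊕ V ⊕ (La ⊕ Z ⊕ Lb) ⊕ R ⊜ C ⊕ V ⊕ (X ⊕ Z ⊕ Lb) ⊕ La ⊕ R)
              ↭-refl X C ⟨ v ⟩ La ⟨ z ⟩ Lb R) uX)
      where
      -- Y replaces L; the part La of L becomes free again.
      cut : ∀ {y} La Lb Y → L ≡ La ++ Lb → Arm G v Y y → y ∈ C → y ≢ u₂ → length Y ≡ length X + length Lb →
        Unique (C ++ v ∷ Y ++ La ++ R) →
        length X ≤ length L × (O (head L u₁) (head R u₂) → length X ≤ non v L)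
      cut {y} La Lb Y refl aY y∈ y≢ lenY uY = X≤L , X≤non
        where
        X≤La : length X ≤ length La
        X≤La = linear _ _ 0
          (subst₂ _≤_ (cong (_+ length R) lenY) (cong (_+ length R) (length-++ La))
            (max (oreFan Y R aY aR y∈ ∈₂ y≢ (unique-⊑ La uY
              (solve 5 (λ C V Y La R → C ⊕ V ⊕ Y ⊕ La ⊕ R ⊜ (C ⊕ V ⊕ Y ⊕ R) ⊕ La) ↭-refl C ⟨ v ⟩ Y La R)))))
          (lemma (length X) (length La) (length Lb) (length R))
          where
          lemma : ∀ x a b r → x + (a + b + r) + 0 ≡ a + (x + b + r)
          lemma = solve-∀
        X≤L : length X ≤ length L
        X≤L = ℕ.≤-trans X≤La (subst (length La ≤_) (sym (length-++ La)) (ℕ.m≤m+n _ _))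
        X≤non : O (head L u₁) (head R u₂) → length X ≤ non v L
        X≤non o with splitLast (adj? G v) La
        -- A nonempty arm starts at a neighbour of `v`, so `La` is empty here.
        X≤non o | inj₁ none = ℕ.≤-trans X≤La (subst (_≤ non v (La ++ Lb)) (sym (prefix-nbr La aL none)) z≤n)
        X≤non o | inj₂ (Lc , z , Ld , refl , vz , none) = begin
          length X ≤⟨ linear _ _ 0
            (subst₂ _≤_ (cong₂ (λ a b → a + suc b) lenY (trans (length-++ (reverse Lc)) (cong (_+ length R) (length-reverse Lc))))
              (cong (_+ length R) (trans (length-++ (Lc ++ z ∷ Ld)) (cong (_+ length Lb) (length-++ Lc))))
              (max (oreFan Y (z ∷ reverse Lc ++ R) aY (vz , turn) y∈ ∈₂ y≢ uniq)))
            (lemma (length X) (length Lc) (length Ld) (length Lb) (length R)) ⟩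
          length Ld ≡⟨ cong length (List.filter-all (λ u → ¬? (adj? G v u)) none) ⟨
          non v Ld ≡⟨ count-reject (λ u → ¬? (adj? G v u)) {us = Ld} (λ ¬vz → ¬vz vz) ⟨
          non v (z ∷ Ld) ≤⟨ count-++-≤ʳ (λ u → ¬? (adj? G v u)) Lc (z ∷ Ld) ⟩
          non v (Lc ++ z ∷ Ld) ≤⟨ count-++-≤ˡ (λ u → ¬? (adj? G v u)) (Lc ++ z ∷ Ld) Lb ⟩
          non v L ∎
          where
          open ℕ.≤-Reasoning
          turn : Walk O z (reverse Lc ++ R) u₂
          turn = turn-around G Lc R (subst (λ l → Arm G v l u₁) (++-assoc Lc (z ∷ Ld) Lb) aL) aR
                   (subst (λ l → O (head l u₁) (head R u₂)) (++-assoc Lc (z ∷ Ld) Lb) o)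
          uniq : Unique (C ++ v ∷ Y ++ z ∷ reverse Lc ++ R)
          uniq = unique-⊑ Ld uY
            (solve 7 (λ C V Y Lc Z Ld R → C ⊕ V ⊕ Y ⊕ (Lc ⊕ Z ⊕ Ld) ⊕ R ⊜ Lc ⊕ C ⊕ V ⊕ Y ⊕ Z ⊕ R ⊕ Ld)
              ↭-refl C ⟨ v ⟩ Y Lc ⟨ z ⟩ Ld R
             ▹ ++⁺ʳ _ (↭-sym (↭-reverse Lc))
             ▹ solve 7 (λ C V Y Lc Z Ld R → Lc ⊕ C ⊕ V ⊕ Y ⊕ Z ⊕ R ⊕ Ld ⊜ (C ⊕ V ⊕ Y ⊕ Z ⊕ Lc ⊕ R) ⊕ Ld)
              ↭-refl C ⟨ v ⟩ Y (reverse Lc) ⟨ z ⟩ Ld R)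
          lemma : ∀ x c d b r → x + (c + suc d + b + r) + 0 ≡ d + (x + b + suc (c + r))
          lemma = solve-∀

    -- A greedily grown path: members of `K` are put on top while they form an Ore pair with the
    -- current top. `covers` is only an inequality because the path from `K` to the fan may pass
    -- through vertices outside `K`.
    record Attachment (F : OreFan C v) (K : List V) : Set where
      constructor attachment
      open OreFan F using (L; R)
      field
        {top tip} : V
        {body rest} : List V
        top∈ : top ∈ K
        walk : Walk O top body tip
        rest⊆ : ∀ {k} → k ∈ rest → k ∈ K
        tip∈ : tip ∈ C ++ L ++ R
        unique : Unique (rest ++ top ∷ body ++ C ++ v ∷ L ++ R)
        covers : length K ≤ length (top ∷ body) + length rest
        far : ∀ {k} → k ∈ rest → Far G k top

    module _ (conn : 2 -Connected G) (F : OreFan C v) where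

      open OreFan F hiding (size; unique)
      private
        M = C ++ v ∷ L ++ R

        thin : ∀ {a} → a ∈ C ++ L ++ R → a ∈ M
        thin i = [ ∈-++⁺ˡ , (λ j → ∈-++⁺ʳ C (there j)) ]′ (∈-++⁻ C i)

        grow : ∀ j K {h t z} → length K ≤ j → Walk O h t z → Unique (K ++ h ∷ t ++ M) → z ∈ C ++ L ++ R →
          ∀ {K₀} → h ∈ K₀ → (∀ {k} → k ∈ K → k ∈ K₀) → length K₀ ≤ length (h ∷ t) + length K →
          Attachment F K₀
        grow j K {h} {t} j≥ w u z∈ h∈ K⊆ le with splitLast (λ k → ore? G k h) K
        ... | inj₁ none = attachment h∈ w K⊆ z∈ u le
          (λ i → (λ { refl → unique-disjoint K u i (here refl) }) , All.lookup none i)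
        grow (suc j) _ {h} {t} j≥ w u z∈ h∈ K⊆ le | inj₂ (ys , k , zs , refl , o , _) =
          grow j (ys ++ zs) (ℕ.≤-pred (subst (_≤ suc j) len j≥)) (o ∷ w)
            (unique-resp-↭ (solve 6 (λ Y K Z H T M → (Y ⊕ K ⊕ Z) ⊕ H ⊕ T ⊕ M ⊜ (Y ⊕ Z) ⊕ K ⊕ H ⊕ T ⊕ M)
              ↭-refl ys ⟨ k ⟩ zs ⟨ h ⟩ t M) u) z∈
            (K⊆ (∈-++⁺ʳ ys (here refl)))
            (λ i → K⊆ (∈-resp-↭ (↭-sym (shift k ys zs)) (there i)))
            (ℕ.≤-trans le (ℕ.≤-reflexive (trans (cong (length (h ∷ t) +_) len) (ℕ.+-suc (length (h ∷ t)) (length (ys ++ zs))))))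
          where
          len : length (ys ++ k ∷ zs) ≡ suc (length (ys ++ zs))
          len = ↭-length (shift k ys zs)
        grow zero _ j≥ _ _ _ _ _ _ | inj₂ (ys , k , zs , refl , _)
          with () ← subst (_≤ 0) (↭-length (shift k ys zs)) j≥

      attach : ∀ {K k} → k ∈ K → Unique K → (∀ {a} → a ∈ K → a ∉ M) → Attachment F K
      attach {K} k∈ uK K∉
        with detour {from = a} {via = r} a∈ z∈ _ w u av ← exit G conn v {K = K} {Z = C ++ L ++ R} k∈
               (λ i → K∉ k∈ (thin i)) (λ { refl → K∉ k∈ (∈-++⁺ʳ C (here refl)) })
               (∈-++⁺ˡ u₁∈) (λ { refl → unique-disjoint C (OreFan.unique F) u₁∈ (here refl) })
        with K′ , p ← ∈-∃↭ a∈
        = grow (length K′) K′ ℕ.≤-refl (walk-map inj₁ w) uniq z∈ a∈ (λ i → ∈-resp-↭ (↭-sym p) (there i))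
            (ℕ.≤-trans (ℕ.≤-reflexive (↭-length p)) (s≤s (ℕ.m≤n+m _ (length r))))
        where
        via∉ : ∀ {s} → s ∈ r → s ∉ M
        via∉ i j with _ , s∉ , s≢ ← All.lookup av i with ∈-++⁻ C j
        ... | inj₁ k = s∉ (∈-++⁺ˡ k)
        ... | inj₂ (here refl) = s≢ refl
        ... | inj₂ (there k) = s∉ (∈-++⁺ʳ C k)
        uniq : Unique (K′ ++ a ∷ r ++ M)
        uniq = unique-resp-↭ (↭-trans (++⁺ʳ (r ++ M) p)
                 (solve 4 (λ K A S M → A ⊕ K ⊕ S ⊕ M ⊜ K ⊕ A ⊕ S ⊕ M) ↭-refl K′ ⟨ a ⟩ r M))
          (unique-++ uK (unique-++ u (OreFan.unique F) via∉)
            (λ i j → [ (λ l → proj₁ (All.lookup av l) i) , K∉ i ]′ (∈-++⁻ r j)))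

    -- Otherwise `w`, put in front of the arm, would give a larger fan.
    far-head : ∀ (F : OreFan C v) → (∀ (F′ : OreFan C v) → size F′ ≤ size F) → ∀ {w} → v ~ w →
      w ∉ C ++ v ∷ OreFan.L F ++ OreFan.R F → Far G w (OreFan.head₁ F)
    far-head F@(oreFan {u₁} {u₂} L R aL aR ∈₁ ∈₂ ne u) max {w} vw w∉ = w≢ L refl , λ o → ℕ.1+n≰n
      (max (oreFan (w ∷ L) R (vw , arm-hop G L aL o) aR ∈₁ ∈₂ ne
        (unique-resp-↭ (solve 5 (λ W C V L R → W ⊕ C ⊕ V ⊕ L ⊕ R ⊜ C ⊕ V ⊕ (W ⊕ L) ⊕ R) ↭-refl ⟨ w ⟩ C ⟨ v ⟩ L R)
          (unique-∷ w∉ u))))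
      where
      w≢ : ∀ l → l ≡ L → w ≢ head l u₁
      w≢ [] _ refl = w∉ (∈-++⁺ˡ ∈₁)
      w≢ (x ∷ l) refl refl = w∉ (∈-++⁺ʳ C (there (here refl)))

    module Maximal (conn : 2 -Connected G) (claw : NoFarClaw G v)
                   (F : OreFan C v) (max : ∀ (F′ : OreFan C v) → size F′ ≤ size F) where

      open OreFan F hiding (size; unique)
      private
        M = C ++ v ∷ L ++ R
        B = missed F
        h₁ = head₁
        h₂ = head₂

      max-swap : ∀ F′ → size F′ ≤ size (swap-oreFan F)
      max-swap F′ = subst (size F′ ≤_) (ℕ.+-comm (length L) (length R)) (max F′)

      M-swap : M ↭ C ++ v ∷ R ++ L
      M-swap = solve 4 (λ C V L R → C ⊕ V ⊕ L ⊕ R ⊜ C ⊕ V ⊕ R ⊕ L) ↭-refl C ⟨ v ⟩ L R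

      far₁ : ∀ {w} → w ∈ B → Far G w h₁
      far₁ i = far-head F max (missed-adj F i) (missed-∉ F i)

      far₂ : ∀ {w} → w ∈ B → Far G w h₂
      far₂ i = far-head (swap-oreFan F) max-swap (missed-adj F i) (missed-∉ F i ∘ ∈-resp-↭ (↭-sym M-swap))

      heads-differ : h₁ ≢ h₂
      heads-differ = go L R u₁∈ u₂∈ u₁≢u₂ (OreFan.unique F)
        where
        go : ∀ L R {u₁ u₂} → u₁ ∈ C → u₂ ∈ C → u₁ ≢ u₂ → Unique (C ++ v ∷ L ++ R) → head L u₁ ≢ head R u₂
        go [] [] ∈₁ ∈₂ ne u eq = ne eq
        go [] (y ∷ R) ∈₁ ∈₂ ne u refl = unique-disjoint C u ∈₁ (there (here refl))
        go (x ∷ L) [] ∈₁ ∈₂ ne u refl = unique-disjoint C u ∈₂ (there (here refl))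
        go (x ∷ L) (y ∷ R) ∈₁ ∈₂ ne u refl = unique-disjoint (x ∷ L) (AllPairs.tail (unique-++ʳ C u)) (here refl) (here refl)

      attached-≤ : ∀ {K} → (∀ {k} → k ∈ K → k ∈ B) → (a : Attachment F K) →
        length (Attachment.top a ∷ Attachment.body a) ≤ length L + length R
        × (O h₁ h₂ → length (Attachment.top a ∷ Attachment.body a) ≤ non v L + non v R)
      attached-≤ K⊆ (attachment {x} {z} {xs} {rest} x∈ w _ z∈ u _ _) = case ∈-++⁻ C z∈ of λ where
          (inj₁ z∈C) → case z ≟ u₂ of λ where
            (no z≢) → left (inj₁ (z∈C , z≢))
            (yes refl) → right (inj₁ (z∈C , u₁≢u₂ ∘ sym))
          (inj₂ z∈LR) → case ∈-++⁻ L z∈LR of λ where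
            (inj₁ z∈L) → left (inj₂ z∈L)
            (inj₂ z∈R) → right (inj₂ z∈R)
        where
        X = x ∷ xs
        uX = unique-++ʳ rest u
        Goal = length X ≤ length L + length R × (O h₁ h₂ → length X ≤ non v L + non v R)
        left : (z ∈ C × z ≢ u₂) ⊎ z ∈ L → Goal
        left s with p , q ← insertion F max X (missed-adj F (K⊆ x∈) , w) uX s
          = ℕ.m≤n⇒m≤n+o _ p , λ o → ℕ.m≤n⇒m≤n+o _ (q o)
        right : (z ∈ C × z ≢ u₁) ⊎ z ∈ R → Goal
        right s with p , q ← insertion (swap-oreFan F) max-swap X (missed-adj F (K⊆ x∈) , w)
                               (unique-resp-↭ (++⁺ˡ X M-swap) uX) s
          = ℕ.m≤n⇒m≤o+n _ p , λ o → ℕ.m≤n⇒m≤o+n _ (q (ore-sym G o))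

      adj₁ : v ~ h₁
      adj₁ = arm-head G L armL

      adj₂ : v ~ h₂
      adj₂ = arm-head G R armR

      some : ∀ {l : List V} → 1 ≤ length l → ∃ λ x → x ∈ l
      some {x ∷ _} _ = x , here refl

      all-covered : ∀ {K} (a : Attachment F K) → (∀ {k} → k ∈ Attachment.rest a → ⊥) →
        length K ≤ length (Attachment.top a ∷ Attachment.body a)
      all-covered a none with Attachment.rest a | Attachment.covers a
      ... | [] | le = ℕ.≤-trans le (ℕ.≤-reflexive (ℕ.+-identityʳ (length (Attachment.top a ∷ Attachment.body a))))
      ... | k ∷ _ | _ = ⊥-elim (none (here refl))

      missed-covered : (a : Attachment F B) → (∀ {k} → k ∈ Attachment.rest a → ⊥) →
        suc (size F + 2 * (non v L + non v R)) ≤ length (Attachment.top a ∷ Attachment.body a)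
      missed-covered a none = ℕ.≤-trans (missed-large F) (all-covered a none)

      -- Both heads, `top` and a leftover vertex would be four pairwise far neighbours of `v`. So
      -- one attachment takes up all of `B`, which is longer than both arms together.
      far-heads : ¬ O h₁ h₂ → Attachment F B → ⊥
      far-heads ¬o att = ℕ.1+n≰n (ℕ.≤-trans (s≤s (ℕ.m≤m+n (size F) _))
          (ℕ.≤-trans (missed-covered att (λ i → claw adj₁ adj₂ (missed-adj F top∈) (missed-adj F (rest⊆ i))
              (heads-differ , ¬o) (far-sym G (far₁ top∈)) (far-sym G (far₁ (rest⊆ i)))
              (far-sym G (far₂ top∈)) (far-sym G (far₂ (rest⊆ i))) (far-sym G (far i))))
            (proj₁ (attached-≤ id att))))
        where open Attachment att

      -- Now only one head is available: with it, the two tops and a leftover vertex would be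
      -- pairwise far. So two attachments exhaust `B`, and the sharper bound of `insertion` applies
      -- to each.
      near-heads : O h₁ h₂ → (att : Attachment F B) → Attachment F (Attachment.rest att) → ⊥
      near-heads o att att′ = ℕ.1+n≰n (begin
          suc (2 * (non v L + non v R)) ≤⟨ s≤s (ℕ.m≤n+m _ (size F)) ⟩
          suc (size F + 2 * (non v L + non v R)) ≤⟨ missed-large F ⟩
          length B ≤⟨ covers ⟩
          length (top ∷ body) + length rest ≤⟨ ℕ.+-mono-≤ (proj₂ (attached-≤ id att) o) (ℕ.≤-trans
            (all-covered att′ λ i → claw adj₂ (missed-adj F top∈) (missed-adj F (rest⊆ top′∈)) (missed-adj F (rest⊆ (rest⊆′ i)))
              (far-sym G (far₂ top∈)) (far-sym G (far₂ (rest⊆ top′∈))) (far-sym G (far₂ (rest⊆ (rest⊆′ i))))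
              (far-sym G (far top′∈)) (far-sym G (far (rest⊆′ i))) (far-sym G (far′ i)))
            (proj₂ (attached-≤ rest⊆ att′) o)) ⟩
          non v L + non v R + (non v L + non v R) ≡⟨ cong (non v L + non v R +_) (ℕ.+-identityʳ _) ⟨
          2 * (non v L + non v R) ∎)
        where
        open ℕ.≤-Reasoning
        open Attachment att
        open Attachment att′ using () renaming (top∈ to top′∈; rest⊆ to rest⊆′; far to far′)

      near-heads′ : O h₁ h₂ → Attachment F B → ⊥
      near-heads′ o att = go rest refl
        where
        open Attachment att
        go : ∀ l → rest ≡ l → ⊥
        go [] eq = ℕ.1+n≰n (begin
          suc (non v L + non v R) ≤⟨ s≤s (ℕ.≤-trans (ℕ.m≤m+n _ _) (ℕ.m≤n+m _ (size F))) ⟩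
          suc (size F + 2 * (non v L + non v R)) ≤⟨ missed-covered att (λ {k} i → case subst (k ∈_) eq i of λ ()) ⟩
          length (top ∷ body) ≤⟨ proj₂ (attached-≤ id att) o ⟩
          non v L + non v R ∎)
          where open ℕ.≤-Reasoning
        go (k ∷ l) eq = near-heads o att
          (attach conn F (subst (k ∈_) (sym eq) (here refl)) (unique-++ˡ rest unique) (missed-∉ F ∘ rest⊆))

      absurd : ⊥
      absurd with a , a∈ ← some (ℕ.≤-trans (s≤s z≤n) (missed-large F)) | ore? G h₁ h₂
      ... | yes o = near-heads′ o (attach conn F a∈ (missed-unique F) (missed-∉ F))
      ... | no ¬o = far-heads ¬o (attach conn F a∈ (missed-unique F) (missed-∉ F))

    -- A maximal fan is obtained without a search: as the goal is absurdity, a larger fan may be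
    -- refuted by induction on `k`, which bounds the room left for growth.
    no-oreFan : 2 -Connected G → NoFarClaw G v → ∀ k (F : OreFan C v) → n ≤ k + size F → ⊥
    no-oreFan conn claw zero F@(oreFan L R _ _ _ _ _ u) le with N , p ← outside G u = ℕ.1+n≰n (begin
      suc n ≤⟨ s≤s le ⟩
      suc (size F) ≤⟨ ℕ.m≤n+m _ (length C) ⟩
      length C + suc (length L + length R) ≡⟨ cong (λ k → length C + suc k) (length-++ L) ⟨
      length C + length (v ∷ L ++ R) ≡⟨ length-++ C ⟨
      length (C ++ v ∷ L ++ R) ≤⟨ ℕ.m≤m+n _ (length N) ⟩
      length (C ++ v ∷ L ++ R) + length N ≡⟨ length-outside G (C ++ v ∷ L ++ R) p ⟩
      n ∎)
      where open ℕ.≤-Reasoning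
    no-oreFan conn claw (suc k) F le = Maximal.absurd conn claw F λ F′ → case size F′ ℕ.≤? size F of λ where
      (yes p) → p
      (no ¬p) → ⊥-elim (no-oreFan conn claw k F′
        (ℕ.≤-trans le (subst (_≤ k + size F′) (ℕ.+-suc k (size F)) (ℕ.+-monoʳ-≤ k (ℕ.≰⇒> ¬p)))))

    two-vertices : ∀ {a l} → IsCycle G _~_ a l → ∃ λ q → q ∈ l × a ≢ q
    two-vertices {l = x ∷ l} (cyc _ (p ∷ _) _) = x , here refl , All.head p
    two-vertices {l = []} (cyc _ _ ())

    heavy-on-cycle : 2 -Connected G → NoFarClaw G v → v ∈ C
    heavy-on-cycle conn claw with v ∈? C
    ... | yes v∈ = v∈
    ... | no v∉ with q , q∈ , ne ← two-vertices cycle =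
      ⊥-elim (no-oreFan conn claw n (fan⇒oreFan (fan-exists G conn (IsCycle.unique cycle) (here refl) (there q∈) ne v v∉))
        (ℕ.m≤m+n n _))

-- Induced stars

≅-sym : ∀ {V W} {G : Graph V} {H : Graph W} → G ≅ H → H ≅ G
≅-sym {G = G} {H} φ = record
  { bijection = Symmetry.↔-sym (_≅_.bijection φ)
  ; adjacency = λ u v → mk⇔
      (λ e → Equivalence.from (_≅_.adjacency φ _ _)
        (subst₂ (Adj H) (sym (Inverse.strictlyInverseˡ b u)) (sym (Inverse.strictlyInverseˡ b v)) e))
      (λ e → subst₂ (Adj H) (Inverse.strictlyInverseˡ b u) (Inverse.strictlyInverseˡ b v)
        (Equivalence.to (_≅_.adjacency φ _ _) e))
  }
  where b = _≅_.bijection φ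

≅-trans : ∀ {V W X} {G : Graph V} {H : Graph W} {K : Graph X} → G ≅ H → H ≅ K → G ≅ K
≅-trans φ ψ = record
  { bijection = Composition.inverse (_≅_.bijection φ) (_≅_.bijection ψ)
  ; adjacency = λ u v → Composition.equivalence (_≅_.adjacency φ u v) (_≅_.adjacency ψ _ _)
  }

free⇒heavy : ∀ {m n} {S : Graph (Fin m)} {G : Graph (Fin n)} → S -Free G → S -Heavy G
free⇒heavy free W φ = ⊥-elim (free W φ)

heavy-resp-≅ : ∀ {m k n} {S : Graph (Fin m)} {T : Graph (Fin k)} {G : Graph (Fin n)} →
  S ≅ T → S -Heavy G → T -Heavy G
heavy-resp-≅ φ h W ψ = h W (≅-trans ψ (≅-sym φ))

image : ∀ {m n} → (Fin m → Fin n) → Subset n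
image f = Vec.tabulate (λ v → does (any? (λ i → f i ≟ v)))

∈-image : ∀ {m n} (f : Fin m → Fin n) i → f i ∈ₛ image f
∈-image f i = lookup⇒[]= (f i) _
  (trans (lookup∘tabulate _ (f i)) (dec-true (any? (λ j → f j ≟ f i)) (i , refl)))

image-∈ : ∀ {m n} (f : Fin m → Fin n) {v} → v ∈ₛ image f → ∃ λ i → f i ≡ v
image-∈ f {v} v∈ with any? (λ i → f i ≟ v) | trans (sym (lookup∘tabulate _ v)) ([]=⇒lookup v∈)
... | yes p | _ = p
... | no _ | ()

embedding⇒induced : ∀ {m n} {H : Graph (Fin m)} {G : Graph (Fin n)} (f : Fin m → Fin n) →
  (∀ {i j} → f i ≡ f j → i ≡ j) → (∀ i j → Adj G (f i) (f j) ⇔ Adj H i j) → G [ image f ] ≅ H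
embedding⇒induced {H = H} {G} f inj adj = ≅-sym {G = H} {G [ image f ]} record
  { bijection = mk↔ₛ′ (λ i → f i , ∈-image f i) (λ (v , v∈) → proj₁ (image-∈ f v∈))
      (λ (v , v∈) → ∃-≡ (proj₂ (image-∈ f v∈)))
      (λ i → inj (proj₂ (image-∈ f (∈-image f i))))
  ; adjacency = λ i j → Symmetry.⇔-sym (adj i j)
  }
  where
  ∃-≡ : ∀ {i v} {v∈ : v ∈ₛ image f} → f i ≡ v → (f i , ∈-image f i) ≡ (v , v∈)
  ∃-≡ {i} {v∈ = v∈} refl = cong (f i ,_) ([]=-irrelevant _ v∈)

module _ {n} (G : Graph (Fin n)) where

  -- The centre is adjacent to every leaf, so the nonadjacent pair supplied by heaviness consists of
  -- two leaves.
  star-heavy : ∀ {k v} → star k -Heavy G → (f : Fin k → Fin n) → (∀ i → Adj G v (f i)) →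
    (∀ {i j} → i ≢ j → Far G (f i) (f j)) → ⊥
  star-heavy {k} {v} heavy f adj far = no-pair (heavy (image F) (embedding⇒induced {H = star k} {G} F F-inj F-adj))
    where
    F : Fin (suc k) → Fin n
    F zero = v
    F (suc i) = f i
    v≢ : ∀ {i} → v ≢ f i
    v≢ {i} eq = ~-irrefl G (subst (Adj G v) (sym eq) (adj i))
    F-inj : ∀ {i j} → F i ≡ F j → i ≡ j
    F-inj {zero} {zero} eq = refl
    F-inj {zero} {suc j} eq = ⊥-elim (v≢ eq)
    F-inj {suc i} {zero} eq = ⊥-elim (v≢ (sym eq))
    F-inj {suc i} {suc j} eq with i ≟ j
    ... | yes refl = refl
    ... | no ne = ⊥-elim (proj₁ (far ne) eq)
    F-adj : ∀ i j → Adj G (F i) (F j) ⇔ Adj (star k) i j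
    F-adj zero zero = mk⇔ (⊥-elim ∘ ~-irrefl G) (λ { (inj₁ (_ , ne)) → ⊥-elim (ne refl) ; (inj₂ (_ , ne)) → ⊥-elim (ne refl) })
    F-adj zero (suc j) = mk⇔ (λ _ → inj₁ (refl , λ ())) (λ _ → adj j)
    F-adj (suc i) zero = mk⇔ (λ _ → inj₂ (refl , λ ())) (λ _ → ~-sym G (adj i))
    F-adj (suc i) (suc j) = mk⇔ leaves (λ { (inj₁ (() , _)) ; (inj₂ (() , _)) })
      where
      leaves : Adj G (f i) (f j) → Adj (star k) (suc i) (suc j)
      leaves e with i ≟ j
      ... | yes refl = ⊥-elim (~-irrefl G e)
      ... | no ne = ⊥-elim (proj₂ (far ne) (inj₁ e))
    pair : ∀ i j → F i ≢ F j → ¬ Adj G (F i) (F j) → ¬ (n ≤ degree G (F i) + degree G (F j))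
    pair zero zero ne = ⊥-elim (ne refl)
    pair zero (suc j) _ ¬e = ⊥-elim (¬e (adj j))
    pair (suc i) zero _ ¬e = ⊥-elim (¬e (~-sym G (adj i)))
    pair (suc i) (suc j) ne _ le = proj₂ (far (λ { refl → ne refl })) (inj₂ (ne , le))
    no-pair : ¬ (∃ λ u → ∃ λ w → u ∈ₛ image F × w ∈ₛ image F × u ≢ w × ¬ Adj G u w × n ≤ degree G u + degree G w)
    no-pair (u , w , u∈ , w∈ , u≢w , ¬e , le) with i , refl ← image-∈ F u∈ | j , refl ← image-∈ F w∈ =
      pair i j u≢w ¬e le

  -- Four pairwise far neighbours contain k of them, so all stars with at most four leaves are
  -- treated at once.
  star-heavy⇒noFarClaw : ∀ {k} → k ≤ 4 → star k -Heavy G → ∀ v → NoFarClaw G v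
  star-heavy⇒noFarClaw k≤4 heavy v {a} {b} {c} {d} va vb vc vd ab ac ad bc bd cd =
    star-heavy heavy (λ i → leaf (inject≤ i k≤4)) (λ i → leaf-adj (inject≤ i k≤4))
      (λ ne → leaf-far _ _ (ne ∘ inject≤-injective k≤4 k≤4 _ _))
    where
    leaf : Fin 4 → Fin n
    leaf 0F = a
    leaf 1F = b
    leaf 2F = c
    leaf 3F = d
    leaf-adj : ∀ i → Adj G v (leaf i)
    leaf-adj 0F = va
    leaf-adj 1F = vb
    leaf-adj 2F = vc
    leaf-adj 3F = vd
    leaf-far : ∀ i j → i ≢ j → Far G (leaf i) (leaf j)
    leaf-far 0F 1F _ = ab
    leaf-far 0F 2F _ = ac
    leaf-far 0F 3F _ = ad
    leaf-far 1F 2F _ = bc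
    leaf-far 1F 3F _ = bd
    leaf-far 2F 3F _ = cd
    leaf-far 1F 0F _ = far-sym G ab
    leaf-far 2F 0F _ = far-sym G ac
    leaf-far 3F 0F _ = far-sym G ad
    leaf-far 2F 1F _ = far-sym G bc
    leaf-far 3F 1F _ = far-sym G bd
    leaf-far 3F 2F _ = far-sym G cd
    leaf-far 0F 0F ne = ⊥-elim (ne refl)
    leaf-far 1F 1F ne = ⊥-elim (ne refl)
    leaf-far 2F 2F ne = ⊥-elim (ne refl)
    leaf-far 3F 3F ne = ⊥-elim (ne refl)

  isCycle⇒cycle : ∀ {a l} → IsCycle G (Adj G) a l → Cycle G
  isCycle⇒cycle {a} {l} (cyc w u le) = record
    { start = a ; rest = l ; distinct = u ; closed = walk⇒linked w ; length≥3 = s≤s le }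

  cycle⇒isCycle : (C : Cycle G) → IsCycle G (Adj G) (Cycle.start C) (Cycle.rest C)
  cycle⇒isCycle C = cyc (linked⇒walk (Cycle.rest C) (Cycle.closed C)) (Cycle.distinct C) (ℕ.≤-pred (Cycle.length≥3 C))

  everyLongestCycleHeavy : 2 -Connected G → (∀ v → NoFarClaw G v) → EveryLongestCycleHeavy G
  everyLongestCycleHeavy conn claw C longest v heavy =
    Missing.LongestCycle.heavy-on-cycle G (cycle⇒isCycle C)
      (λ D → ℕ.≤-pred (longest (isCycle⇒cycle D))) heavy conn (claw v)

-- Sufficiency of the three graphs

does⇔ : ∀ {P Q : Set} (p? : Dec P) (q? : Dec Q) → does p? ≡ does q? → P ⇔ Q
does⇔ (yes p) (yes q) _ = mk⇔ (λ _ → q) (λ _ → p)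
does⇔ (no ¬p) (no ¬q) _ = mk⇔ (⊥-elim ∘ ¬p) (⊥-elim ∘ ¬q)

path3≅star2 : path 3 ≅ star 2
path3≅star2 = record
  { bijection = mk↔ₛ′ swap swap swap-swap swap-swap
  ; adjacency = adj
  }
  where
  swap : Fin 3 → Fin 3
  swap 0F = 1F
  swap 1F = 0F
  swap 2F = 2F
  swap-swap : ∀ i → swap (swap i) ≡ i
  swap-swap 0F = refl
  swap-swap 1F = refl
  swap-swap 2F = refl
  agree : ∀ u v → does (adj? (path 3) u v) ≡ does (adj? (star 2) (swap u) (swap v))
  agree 0F 0F = refl
  agree 0F 1F = refl
  agree 0F 2F = refl
  agree 1F 0F = refl
  agree 1F 1F = refl
  agree 1F 2F = refl
  agree 2F 0F = refl
  agree 2F 1F = refl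
  agree 2F 2F = refl

  adj : ∀ u v → Adj (path 3) u v ⇔ Adj (star 2) (swap u) (swap v)
  adj u v = does⇔ (adj? (path 3) u v) (adj? (star 2) (swap u) (swap v)) (agree u v)

heavy-sufficient : ∀ {m} {S : Graph (Fin m)} → S ≅ path 3 ⊎ S ≅ star 3 ⊎ S ≅ star 4 →
  ∀ n (G : Graph (Fin n)) → 2 -Connected G → S -Heavy G → EveryLongestCycleHeavy G
heavy-sufficient φ n G conn heavy = everyLongestCycleHeavy G conn (claw φ)
  where
  claw : _ → ∀ v → NoFarClaw G v
  claw (inj₁ φ) = star-heavy⇒noFarClaw G (ℕ.m≤m+n 2 2) (heavy-resp-≅ {T = star 2} {G} (≅-trans φ path3≅star2) heavy)
  claw (inj₂ (inj₁ φ)) = star-heavy⇒noFarClaw G (ℕ.m≤m+n 3 1) (heavy-resp-≅ {T = star 3} {G} φ heavy)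
  claw (inj₂ (inj₂ φ)) = star-heavy⇒noFarClaw G ℕ.≤-refl (heavy-resp-≅ {T = star 4} {G} φ heavy)

-- Graphs without triangles, induced P₄ and induced C₄

module _ {m n} {S : Graph (Fin m)} {G : Graph (Fin n)} where

  record Embedding : Set where
    field
      map : Fin m → Fin n
      injective : ∀ {i j} → map i ≡ map j → i ≡ j
      preserves : ∀ {i j} → Adj S i j → Adj G (map i) (map j)
      reflects : ∀ {i j} → Adj G (map i) (map j) → Adj S i j

  induced⇒embedding : ∀ {W} → G [ W ] ≅ S → Embedding
  induced⇒embedding {W} φ = record
    { map = λ i → proj₁ (Inverse.from b i)
    ; injective = λ {i} {j} eq → trans (sym (Inverse.strictlyInverseˡ b i))
        (trans (cong (Inverse.to b) (∃-≡ eq)) (Inverse.strictlyInverseˡ b j))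
    ; preserves = λ {i} {j} e → Equivalence.from (_≅_.adjacency φ _ _)
        (subst₂ (Adj S) (sym (Inverse.strictlyInverseˡ b i)) (sym (Inverse.strictlyInverseˡ b j)) e)
    ; reflects = λ {i} {j} e →
        subst₂ (Adj S) (Inverse.strictlyInverseˡ b i) (Inverse.strictlyInverseˡ b j)
          (Equivalence.to (_≅_.adjacency φ _ _) e)
    }
    where
    b = _≅_.bijection φ
    ∃-≡ : ∀ {p q : ∃ λ v → v ∈ₛ W} → proj₁ p ≡ proj₁ q → p ≡ q
    ∃-≡ {_ , i} {_ , j} refl = cong (_ ,_) ([]=-irrelevant i j)

module _ {n} (G : Graph (Fin n)) where

  private
    _~_ = Adj G

  TriangleFree : Set
  TriangleFree = ∀ {a b c} → a ~ b → b ~ c → ¬ a ~ c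

  -- Neither P₄ nor C₄ is an induced subgraph.
  QuasiThreshold : Set
  QuasiThreshold = ∀ {a b c d} → a ~ b → b ~ c → c ~ d → a ≢ c → b ≢ d → ¬ a ~ c → ¬ b ~ d → ⊥

module _ {m n} {S : Graph (Fin m)} {G : Graph (Fin n)} where

  private
    _~_ = Adj S

  triangle-free : TriangleFree G → ∀ {a b c} → a ~ b → b ~ c → a ~ c → S -Free G
  triangle-free tf ab bc ac W φ = tf (preserves ab) (preserves bc) (preserves ac)
    where open Embedding (induced⇒embedding {S = S} {G} φ)

  quasiThreshold-free : QuasiThreshold G → ∀ {a b c d} → a ~ b → b ~ c → c ~ d →
    a ≢ c → b ≢ d → ¬ a ~ c → ¬ b ~ d → S -Free G
  quasiThreshold-free qt ab bc cd a≢c b≢d ¬ac ¬bd W φ =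
    qt (preserves ab) (preserves bc) (preserves cd) (a≢c ∘ injective) (b≢d ∘ injective)
      (¬ac ∘ reflects) (¬bd ∘ reflects)
    where open Embedding (induced⇒embedding {S = S} {G} φ)

universal⇒star : ∀ {k} {S : Graph (Fin (suc k))} → TriangleFree S →
  ∀ centre → (∀ z → z ≢ centre → Adj S z centre) → S ≅ star k
universal⇒star {k} {S} tf centre centre-adj = record
  { bijection = τ
  ; adjacency = λ u v → mk⇔ (to′ u v (u ≟ centre) (v ≟ centre)) (from′ u v)
  }
  where
  _~_ = Adj S
  τ = transpose centre 0F
  to = Inverse.to τ
  τ-centre : to centre ≡ 0F
  τ-centre rewrite dec-true (centre ≟ centre) refl = refl
  centre-only : ∀ {u} → to u ≡ 0F → u ≡ centre
  centre-only {u} eq = trans (sym (Inverse.strictlyInverseʳ τ u))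
    (trans (cong (Inverse.from τ) (trans eq (sym τ-centre))) (Inverse.strictlyInverseʳ τ centre))
  to-centre : ∀ {u} → u ≡ centre → to u ≡ 0F
  to-centre refl = τ-centre
  to′ : ∀ u v → Dec (u ≡ centre) → Dec (v ≡ centre) → u ~ v → Adj (star k) (to u) (to v)
  to′ u v (yes refl) (yes refl) e = ⊥-elim (Graph.irrefl S refl e)
  to′ u v (yes u≡) (no v≢) e = inj₁ (to-centre u≡ , v≢ ∘ centre-only {v})
  to′ u v (no u≢) (yes v≡) e = inj₂ (to-centre v≡ , u≢ ∘ centre-only {u})
  to′ u v (no u≢) (no v≢) e = ⊥-elim (tf e (centre-adj v v≢) (centre-adj u u≢))
  from′ : ∀ u v → Adj (star k) (to u) (to v) → u ~ v
  from′ u v (inj₁ (u≡ , v≢)) with refl ← centre-only {u} u≡ = Graph.sym S (centre-adj v (v≢ ∘ to-centre))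
  from′ u v (inj₂ (v≡ , u≢)) with refl ← centre-only {v} v≡ = centre-adj u (u≢ ∘ to-centre)

module _ {k} {S : Graph (Fin (suc (suc k)))} (conn : Connected S)
         (tf : TriangleFree S) (qt : QuasiThreshold S) where

  private
    V = Fin (suc (suc k))
    _~_ = Adj S

    first-step : ∀ {u v} → Star _~_ u v → u ≢ v → ∃ λ w → u ~ w
    first-step ε ne = ⊥-elim (ne refl)
    first-step (e ◅ _) _ = _ , e

  -- If vertex 0 has two neighbours `b` and `d`, another neighbour `a` of `b` would make `a`, `b`,
  -- 0, `d` an induced `P₄` or `C₄`, as triangles are excluded. Hence 0 or `b` is a leaf.
  pendant-edge : ∃ λ c → ∃ λ l → l ~ c × (∀ {d} → d ~ l → d ≡ c)
  pendant-edge with b , e ← first-step (conn 0F 1F) (λ ())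
    with any? (λ d → adj? S d 0F ×-dec ¬? (d ≟ b))
  ... | no none = b , 0F , e , λ {d} d0 → case d ≟ b of λ where
    (yes eq) → eq
    (no ne) → ⊥-elim (none (d , d0 , ne))
  ... | yes (d , d0 , d≢b) = 0F , b , Graph.sym S e , λ {a} ab → case a ≟ 0F of λ where
    (yes eq) → eq
    (no ne) → ⊥-elim (qt ab (Graph.sym S e) (Graph.sym S d0) ne (d≢b ∘ sym)
      (tf ab (Graph.sym S e)) (λ bd → tf bd d0 (Graph.sym S e)))

  centre : V
  centre = proj₁ pendant-edge

  -- A vertex at distance two from the centre would form an induced `P₄` together with the pendant
  -- edge.
  centre-adj : ∀ z → z ≢ centre → z ~ centre
  centre-adj z z≢ = go (conn z centre) z≢
    where
    c = centre
    l = proj₁ (proj₂ pendant-edge)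
    lc = proj₁ (proj₂ (proj₂ pendant-edge))
    only : ∀ {d} → d ~ l → d ≡ c
    only = proj₂ (proj₂ (proj₂ pendant-edge))
    go : ∀ {z} → Star _~_ z c → z ≢ c → z ~ c
    go ε ne = ⊥-elim (ne refl)
    go {z} (_◅_ {j = e} ze path) z≢c with e ≟ c
    ... | yes refl = ze
    ... | no e≢c with adj? S z c
    ... | yes zc = zc
    ... | no ¬zc with ec ← go path e≢c = ⊥-elim (qt lc (Graph.sym S ec) (Graph.sym S ze)
      (λ { refl → z≢c (only ze) }) (z≢c ∘ sym)
      (λ le → e≢c (only (Graph.sym S le))) (¬zc ∘ Graph.sym S))

  quasiThreshold⇒star : S ≅ star (suc k)
  quasiThreshold⇒star = universal⇒star tf centre centre-adj

-- Each neighbourhood is covered by q cliques, so by pigeonhole two of more than q leaves would be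
-- adjacent.
star-free : ∀ {n k q} {G : Graph (Fin n)} (colour : Fin n → Fin q) →
  (∀ u a → Adj G u a → ∀ b → Adj G u b → a ≢ b → colour a ≡ colour b → Adj G a b) →
  q ℕ.< k → star k -Free G
star-free {k = k} {G = G} colour cliques q<k W φ
  with i , j , i<j , eq ← Fin.pigeonhole q<k (λ i → colour (Embedding.map (induced⇒embedding {S = star k} {G} φ) (suc i)))
  = no-leaves (reflects (cliques (map zero) _ (preserves (inj₁ (refl , λ ()))) _ (preserves (inj₁ (refl , λ ())))
      (λ e → Fin.<⇒≢ i<j (Fin.suc-injective (injective e))) eq))
  where
  open Embedding (induced⇒embedding {S = star k} {G} φ)
  no-leaves : ∀ {i j} → ¬ Adj (star k) (suc i) (suc j)
  no-leaves (inj₁ (() , _))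
  no-leaves (inj₂ (() , _))

-- Certificates for connectivity and for cycle lengths

module _ {n} (G : Graph (Fin (suc n))) where

  private
    V = Fin (suc n)
    _~_ = Adj G

  -- After deleting a vertex a, vertices below a descend to the first vertex and vertices
  -- above a ascend to the last.
  stNumbering⇒2-connected : 2 < suc n →
    (∀ u → u ≡ zero ⊎ ∃ λ w → toℕ w < toℕ u × u ~ w) →
    (∀ u → u ≡ fromℕ n ⊎ ∃ λ w → toℕ u < toℕ w × u ~ w) →
    zero ~ fromℕ n → 2 -Connected G
  stNumbering⇒2-connected 2<n down up closing = 2<n , conn
    where
    module _ (X : Subset (suc n)) (small : ∣ X ∣ < 2) where
      at-most-one : ∀ {a b} → a ∈ₛ X → b ∈ₛ X → a ≡ b
      at-most-one {a} {b} a∈ b∈ with b ≟ a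
      ... | yes eq = sym eq
      ... | no ne = ⊥-elim (ℕ.<-irrefl refl (ℕ.<-≤-trans small (ℕ.≤-trans
        (s≤s (ℕ.≤-trans (s≤s z≤n) (x∈p⇒∣p-x∣<∣p∣ (x∈p∧x≢y⇒x∈p-y b∈ ne)))) (x∈p⇒∣p-x∣<∣p∣ a∈))))

      R : Rel V 0ℓ
      R u v = u ~ v × ¬ u ∈ₛ X × ¬ v ∈ₛ X

      R-sym : Symmetric R
      R-sym (e , u , v) = Graph.sym G e , v , u

      descend : ∀ k u → toℕ u ≤ k → (∀ w → toℕ w ≤ toℕ u → ¬ w ∈ₛ X) → Star R u zero
      descend k u le av with down u
      ... | inj₁ refl = ε
      descend zero u le av | inj₂ (w , w<u , e) with () ← ℕ.<-≤-trans w<u le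
      descend (suc k) u le av | inj₂ (w , w<u , e) =
        (e , av u ℕ.≤-refl , av w (ℕ.<⇒≤ w<u)) ◅
        descend k w (ℕ.≤-pred (ℕ.<-≤-trans w<u le)) (λ z z≤w → av z (ℕ.≤-trans z≤w (ℕ.<⇒≤ w<u)))

      ascend : ∀ k u → n ≤ k + toℕ u → (∀ w → toℕ u ≤ toℕ w → ¬ w ∈ₛ X) → Star R u (fromℕ n)
      ascend k u le av with up u
      ... | inj₁ refl = ε
      ascend zero u le av | inj₂ (w , u<w , e) = ⊥-elim (ℕ.<⇒≱ (ℕ.≤-<-trans le u<w) (Fin.toℕ≤pred[n] w))
      ascend (suc k) u le av | inj₂ (w , u<w , e) =
        (e , av u ℕ.≤-refl , av w (ℕ.<⇒≤ u<w)) ◅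
        ascend k w (ℕ.≤-trans le (subst (_≤ k + toℕ w) (ℕ.+-suc k (toℕ u)) (ℕ.+-monoʳ-≤ k u<w)))
          (λ z w≤z → av z (ℕ.≤-trans (ℕ.<⇒≤ u<w) w≤z))

      terminal : ∀ u → ¬ u ∈ₛ X → (Star R u zero × ¬ zero ∈ₛ X) ⊎ (Star R u (fromℕ n) × ¬ fromℕ n ∈ₛ X)
      terminal u u∉ with any? (λ a → (a ∈ₛ? X) ×-dec (toℕ a ℕ.<? toℕ u))
      ... | no none = inj₁ (descend (toℕ u) u ℕ.≤-refl below , below zero z≤n)
        where
        below : ∀ w → toℕ w ≤ toℕ u → ¬ w ∈ₛ X
        below w w≤u w∈ with ℕ.m≤n⇒m<n∨m≡n w≤u
        ... | inj₁ w<u = none (w , w∈ , w<u)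
        ... | inj₂ eq with refl ← Fin.toℕ-injective eq = u∉ w∈
      ... | yes (a , a∈ , a<u) = inj₂ (ascend n u (ℕ.m≤m+n n _) above ,
                                       above (fromℕ n) (subst (toℕ u ≤_) (sym (Fin.toℕ-fromℕ n)) (Fin.toℕ≤pred[n] u)))
        where
        above : ∀ w → toℕ u ≤ toℕ w → ¬ w ∈ₛ X
        above w u≤w w∈ with refl ← at-most-one a∈ w∈ = ℕ.<⇒≱ a<u u≤w

      link : ∀ u v → ¬ u ∈ₛ X → ¬ v ∈ₛ X → Star R u v
      link u v u∉ v∉ with terminal u u∉ | terminal v v∉
      ... | inj₁ (p , _) | inj₁ (q , _) = p ◅◅ Star.reverse R-sym q
      ... | inj₂ (p , _) | inj₂ (q , _) = p ◅◅ Star.reverse R-sym q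
      ... | inj₁ (p , s∉) | inj₂ (q , t∉) = p ◅◅ ((closing , s∉ , t∉) ◅ Star.reverse R-sym q)
      ... | inj₂ (p , t∉) | inj₁ (q , s∉) = p ◅◅ ((Graph.sym G closing , t∉ , s∉) ◅ Star.reverse R-sym q)

      lift : ∀ {u v} → Star R u v → (u∈ : u ∈ₛ ∁ X) (v∈ : v ∈ₛ ∁ X) → Star (Adj (G [ ∁ X ])) (u , u∈) (v , v∈)
      lift ε u∈ v∈ with refl ← []=-irrelevant u∈ v∈ = ε
      lift ((e , _ , w∉) ◅ p) u∈ v∈ = e ◅ lift p (x∉p⇒x∈∁p w∉) v∈

      conn : Connected (G [ ∁ X ])
      conn (u , u∈) (v , v∈) = lift (link u v (x∈∁p⇒x∉p u∈) (x∈∁p⇒x∉p v∈)) u∈ v∈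

module _ {n} (G : Graph (Fin n)) where

  private
    V = Fin n
    _~_ = Adj G

  rotate : ∀ {a l x} → Walk _~_ a l a → x ∈ a ∷ l → ∃ λ m → Walk _~_ x m x × a ∷ l ↭ x ∷ m
  rotate {l = l} w (here refl) = l , w , ↭-refl
  rotate {a} {l} {x} w (there i) with l₁ , l₂ , refl ← ∈-∃++ i with w₁ , w₂ ← walk-split l₁ w =
    l₂ ++ a ∷ l₁ , w₂ ⟫ w₁ , solve 4 (λ A L₁ X L₂ → A ⊕ L₁ ⊕ X ⊕ L₂ ⊜ X ⊕ L₂ ⊕ A ⊕ L₁) ↭-refl ⟨ a ⟩ l₁ ⟨ x ⟩ l₂

  Avoids : List V → List V → Set
  Avoids Z = All (_∉ Z)

  -- A cycle runs through at most two of the pieces left by the cut {x, y}.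
  two-cut : ∀ {x y k} →
    (∀ {l} → Walk _~_ x l y → Unique l → Avoids (x ∷ y ∷ []) l → length l ≤ k) →
    (∀ {l} → Walk _~_ x l x → Unique l → Avoids (x ∷ y ∷ []) l → length l ≤ k) →
    (∀ {l} → Walk _~_ y l y → Unique l → Avoids (x ∷ y ∷ []) l → length l ≤ k) →
    (∀ {a l} → Walk _~_ a l a → Unique (a ∷ l) → Avoids (x ∷ y ∷ []) (a ∷ l) → length (a ∷ l) ≤ 2 + (k + k)) →
    ∀ {a l} → IsCycle G _~_ a l → suc (length l) ≤ 2 + (k + k)
  two-cut {x} {y} {k} xy xx yy none {a} {l} (cyc w u _) with x ∈? (a ∷ l) | y ∈? (a ∷ l)
  ... | no x∉ | no y∉ = none w u (All.tabulate λ { i (here refl) → x∉ i ; i (there (here refl)) → y∉ i })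
  ... | no x∉ | yes y∈ with m , w′ , p ← rotate w y∈ = ℕ.≤-trans (ℕ.≤-reflexive (↭-length p))
    (s≤s (ℕ.m≤n⇒m≤1+n (ℕ.m≤n⇒m≤n+o k (yy w′ (AllPairs.tail u′)
      (All.tabulate λ { i (here refl) → x∉ (∈-resp-↭ (↭-sym p) (there i)) ; i (there (here refl)) → ∉-head u′ i })))))
    where u′ = unique-resp-↭ p u
  ... | yes x∈ | _ with m , w′ , p ← rotate w x∈ with y ∈? m
  ... | no y∉ = ℕ.≤-trans (ℕ.≤-reflexive (↭-length p))
    (s≤s (ℕ.m≤n⇒m≤1+n (ℕ.m≤n⇒m≤n+o k (xx w′ (AllPairs.tail u′)
      (All.tabulate λ { i (here refl) → ∉-head u′ i ; i (there (here refl)) → y∉ i })))))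
    where u′ = unique-resp-↭ p u
  ... | yes y∈ with m₁ , m₂ , refl ← ∈-∃++ y∈ with w₁ , w₂ ← walk-split m₁ w′ =
    ℕ.≤-trans (ℕ.≤-reflexive (trans (↭-length p) (cong suc (trans (length-++ m₁) (ℕ.+-suc _ _)))))
      (s≤s (s≤s (xy w₁ (unique-++ˡ m₁ (AllPairs.tail u′))
          (All.tabulate λ { i (here refl) → ∉-head u′ (∈-++⁺ˡ i)
                          ; i (there (here refl)) → unique-disjoint m₁ (AllPairs.tail u′) i (here refl) })
        & subst (_≤ k) (length-reverse m₂) (xy (walk-reverse (Graph.sym G) w₂)
            (unique-resp-↭ (↭-sym (↭-reverse m₂)) um₂)
            (All.tabulate λ { i (here refl) → ∉-head u′ (∈-++⁺ʳ m₁ (there (∈-resp-↭ (↭-reverse m₂) i)))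
                            ; i (there (here refl)) → ∉-head (unique-++ʳ m₁ (AllPairs.tail u′)) (∈-resp-↭ (↭-reverse m₂) i) })))))
    where
    u′ = unique-resp-↭ p u
    um₂ : Unique m₂
    um₂ = AllPairs.tail (unique-++ʳ m₁ (AllPairs.tail u′))

  module Colouring (κ : V → ℕ) where

    class : V → ℕ
    class p = count (λ q → κ q ℕ.≟ κ p) (List.allFin n)

    module _ {Z : List V} (separated : ∀ u v → u ~ v → u ∉ Z → v ∉ Z → κ u ≡ κ v) where

      monochromatic : ∀ {a p l b} → Walk _~_ a (p ∷ l) b → Avoids Z (p ∷ l) → All (λ q → κ q ≡ κ p) (p ∷ l)
      monochromatic {l = []} _ _ = refl ∷ []
      monochromatic {p = p} {l = q ∷ l} (_ ∷ w@(e ∷ _)) (p∉ ∷ av) =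
        refl ∷ All.map (λ eq → trans eq (sym (separated p q e p∉ (All.head av)))) (monochromatic w av)

      endpoints : ∀ {p l b} → Walk _~_ p l b → Avoids Z (p ∷ l) → b ∉ Z → κ p ≡ κ b
      endpoints (edge e) (p∉ ∷ _) b∉ = separated _ _ e p∉ b∉
      endpoints (e ∷ w) (p∉ ∷ av) b∉ = trans (separated _ _ e p∉ (All.head av)) (endpoints w av b∉)

      -- With `κ` labelling the pieces left by deleting `Z`, cycle lengths reduce to decidable
      -- checks on single edges and vertices.
      walk-class : ∀ {a p l b} → Walk _~_ a (p ∷ l) b → Unique (p ∷ l) → Avoids Z (p ∷ l) → length (p ∷ l) ≤ class p
      walk-class {p = p} {l} w u av with N , π ← outside G u = begin
        length (p ∷ l) ≡⟨ cong length (List.filter-all (λ q → κ q ℕ.≟ κ p) (monochromatic w av)) ⟨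
        count (λ q → κ q ℕ.≟ κ p) (p ∷ l) ≤⟨ count-++-≤ˡ (λ q → κ q ℕ.≟ κ p) (p ∷ l) N ⟩
        count (λ q → κ q ℕ.≟ κ p) (p ∷ l ++ N) ≡⟨ count-↭ (λ q → κ q ℕ.≟ κ p) π ⟨
        class p ∎
        where open ℕ.≤-Reasoning

-- Symmetrising and removing loops allows a formula to list each edge once and to describe a clique
-- by equality of labels.
fromEdges : ∀ {n} → (Fin n → Fin n → Bool) → Graph (Fin n)
fromEdges f = record
  { Adj = λ u v → u ≢ v × T (f u v ∨ f v u)
  ; adj? = λ u v → ¬? (u ≟ v) ×-dec T? (f u v ∨ f v u)
  ; sym = λ {u} {v} (ne , t) → ne ∘ sym , subst T (∨-comm (f u v) (f v u)) t
  ; irrefl = λ { refl (ne , _) → ne refl }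
  }

-- Three graphs with a longest cycle that is not heavy

StNumbering : ∀ {n} → Graph (Fin (suc n)) → Set
StNumbering {n} G = 2 < suc n × (∀ u → u ≡ zero ⊎ ∃ λ w → toℕ w < toℕ u × Adj G u w) ×
  (∀ u → u ≡ fromℕ n ⊎ ∃ λ w → toℕ u < toℕ w × Adj G u w) × Adj G zero (fromℕ n)

stNumbering? : ∀ {n} (G : Graph (Fin (suc n))) → Dec (StNumbering G)
stNumbering? {n} G = (2 ℕ.<? suc n)
  ×-dec all? (λ u → (u ≟ zero) ⊎-dec any? (λ w → (toℕ w ℕ.<? toℕ u) ×-dec adj? G u w))
  ×-dec all? (λ u → (u ≟ fromℕ n) ⊎-dec any? (λ w → (toℕ u ℕ.<? toℕ w) ×-dec adj? G u w))
  ×-dec adj? G zero (fromℕ n)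

2-connected : ∀ {n} {G : Graph (Fin (suc n))} → StNumbering G → 2 -Connected G
2-connected {G = G} (a , b , c , d) = stNumbering⇒2-connected G a b c d

module _ {n} (G : Graph (Fin n)) where

  private
    _~_ = Adj G

  isCycle? : ∀ a l → Dec (IsCycle G _~_ a l)
  isCycle? a l = map′ (λ (w , u , le) → cyc (linked⇒walk l w) u le) (λ (cyc w u le) → walk⇒linked w , u , le)
    (Linked.linked? (adj? G) (a ∷ (l ∷ʳ a)) ×-dec unique? _≟_ (a ∷ l) ×-dec (2 ℕ.≤? length l))

  misses-heavy : ∀ {a l v} → IsCycle G _~_ a l →
    (∀ {b m} → IsCycle G _~_ b m → suc (length m) ≤ suc (length l)) →
    HeavyVertex G v → v ∉ a ∷ l → ¬ EveryLongestCycleHeavy G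
  misses-heavy C bound heavy v∉ every =
    v∉ (every (isCycle⇒cycle G C) (λ D → bound (cycle⇒isCycle G D)) _ heavy)

  Separates : List (Fin n) → (Fin n → ℕ) → Set
  Separates Z κ = ∀ u v → u ~ v → u ∉ Z → v ∉ Z → κ u ≡ κ v

  separates? : ∀ Z κ → Dec (Separates Z κ)
  separates? Z κ = all? λ u → all? λ v →
    adj? G u v →-dec (¬? (u ∈? Z) →-dec (¬? (v ∈? Z) →-dec (κ u ℕ.≟ κ v)))

infix 4 _==_
_==_ : ℕ → ℕ → Bool
_==_ = ℕ._≡ᵇ_

between : ℕ → ℕ → ℕ → Bool
between a b u = (a ℕ.≤ᵇ u) ∧ (u ℕ.≤ᵇ b)

-- Vertices of G₀ and G₁: the longest cycle x 1 2 3 y 15 16 17 (x = 0, y = 14),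
-- the missed heavy vertex v = 5, and the nine leaves 4, 6, …, 13 at v.
leaf : ℕ → Bool
leaf u = (u == 4) ∨ between 6 13 u

piece : Fin 18 → ℕ
piece u = if between 1 3 (toℕ u) then 1 else if between 15 17 (toℕ u) then 15 else toℕ u

-- The join of the edge xy with K₃ ∪ K₃ ∪ K₁,₉.
G₀ : Graph (Fin 18)
G₀ = fromEdges λ u v → (toℕ u == 0) ∨ (toℕ u == 14) ∨ ((toℕ u == 5) ∧ leaf (toℕ v)) ∨ (piece u == piece v)

-- Here `v` is adjacent to the leaves only. With m leaves its degree is m and n = m + 9, so nine is
-- the least number that makes `v` heavy.
G₁ : Graph (Fin 18)
G₁ = fromEdges λ u v → edge′ (toℕ u) (toℕ v)
  where
  edge′ : ℕ → ℕ → Bool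
  edge′ u v = ((suc u == v) ∧ ((v ℕ.≤ᵇ 3) ∨ (14 ℕ.≤ᵇ u))) ∨ ((u == 3) ∧ (v == 14)) ∨ ((u == 0) ∧ (v == 17))
            ∨ (((u == 0) ∨ (u == 14) ∨ (u == 5)) ∧ leaf v)

-- Hence the bound on cycle lengths in `G₀` serves both graphs.
G₁⊆G₀ : ∀ {u v} → Adj G₁ u v → Adj G₀ u v
G₁⊆G₀ {u} {v} = toWitness {a? = all? λ u → all? λ v → adj? G₁ u v →-dec adj? G₀ u v} tt u v

module G₀-cycles where

  Z : List (Fin 18)
  Z = # 0 ∷ # 14 ∷ # 5 ∷ []

  separates : Separates G₀ Z piece
  separates = toWitness {a? = separates? G₀ Z piece} tt

  open Colouring G₀ piece

  class≤3 : ∀ p → class p ≤ 3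
  class≤3 = toWitness {a? = all? λ p → class p ℕ.≤? 3} tt

  leaf-class : ∀ p → Adj G₀ (# 5) p → p ∉ Z → class p ≤ 1
  leaf-class = toWitness {a? = all? λ p → adj? G₀ (# 5) p →-dec (¬? (p ∈? Z) →-dec (class p ℕ.≤? 1))} tt

  avoids : ∀ {l} → Avoids G₀ (# 0 ∷ # 14 ∷ []) l → # 5 ∉ l → Avoids G₀ Z l
  avoids av 5∉ = All.tabulate λ where
    i (here refl) → All.lookup av i (here refl)
    i (there (here refl)) → All.lookup av i (there (here refl))
    i (there (there (here refl))) → 5∉ i

  at-centre : ∀ {l b} → Walk (Adj G₀) (# 5) l b → Unique l → Avoids G₀ Z l → length l ≤ 1
  at-centre {[]} _ _ _ = z≤n
  at-centre {p ∷ l} w@(e ∷ _) u av = ℕ.≤-trans (walk-class {Z = Z} separates w u av) (leaf-class p e (All.head av))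

  -- The best passage through the star is leaf, centre, leaf: no more vertices than a triangle
  -- offers.
  short : ∀ {a l b} → Walk (Adj G₀) a l b → Unique l → Avoids G₀ (# 0 ∷ # 14 ∷ []) l → length l ≤ 3
  short {l = l} w u av with # 5 ∈? l
  short {l = []} w u av | no 5∉ = z≤n
  short {l = p ∷ l} w u av | no 5∉ = ℕ.≤-trans (walk-class {Z = Z} separates w u (avoids av 5∉)) (class≤3 p)
  short w u av | yes 5∈ with l₁ , l₂ , refl ← ∈-∃++ 5∈ with w₁ , w₂ ← walk-split l₁ w = begin
      length (l₁ ++ # 5 ∷ l₂) ≡⟨ trans (length-++ l₁) (ℕ.+-suc _ _) ⟩
      suc (length l₁ + length l₂) ≤⟨ s≤s (subst (_≤ 1) (length-reverse l₁)
          (at-centre (walk-reverse (Graph.sym G₀) w₁) (unique-resp-↭ (↭-sym (↭-reverse l₁)) (unique-++ˡ l₁ u))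
            (All.tabulate λ i → All.lookup (avoids (All.++⁻ˡ l₁ av) λ j → unique-disjoint l₁ u j (here refl)) (∈-resp-↭ (↭-reverse l₁) i)))
        & at-centre w₂ (AllPairs.tail u₂) (avoids (All.tail (All.++⁻ʳ l₁ av)) (∉-head u₂))) ⟩
      3 ∎
    where
    open ℕ.≤-Reasoning
    u₂ = unique-++ʳ l₁ u

  bound : ∀ {a l} → IsCycle G₀ (Adj G₀) a l → suc (length l) ≤ 8
  bound = two-cut G₀ {k = 3} short short short
    λ w u av → ℕ.≤-trans (s≤s (short w (AllPairs.tail u) (All.tail av))) (ℕ.m≤m+n 4 4)

cycle₀ : List (Fin 18)
cycle₀ = # 1 ∷ # 2 ∷ # 3 ∷ # 14 ∷ # 15 ∷ # 16 ∷ # 17 ∷ []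

cycle₀-misses : # 5 ∉ # 0 ∷ cycle₀
cycle₀-misses = toWitness {a? = ¬? (# 5 ∈? (# 0 ∷ cycle₀))} tt

G₀-connected : 2 -Connected G₀
G₀-connected = 2-connected {G = G₀} (toWitness {a? = stNumbering? G₀} tt)

-- The numbering puts leaf 4 below the centre 5, whose neighbours are all leaves, to give it a lower
-- neighbour.
G₁-connected : 2 -Connected G₁
G₁-connected = 2-connected {G = G₁} (toWitness {a? = stNumbering? G₁} tt)

G₀-bad : ¬ EveryLongestCycleHeavy G₀
G₀-bad = misses-heavy G₀ (toWitness {a? = isCycle? G₀ (# 0) cycle₀} tt) G₀-cycles.bound
  (toWitness {a? = 18 ℕ.≤? 2 * degree G₀ (# 5)} tt) cycle₀-misses

G₁-bad : ¬ EveryLongestCycleHeavy G₁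
G₁-bad = misses-heavy G₁ (toWitness {a? = isCycle? G₁ (# 0) cycle₀} tt)
  (λ { (cyc w u le) → G₀-cycles.bound (cyc (walk-map G₁⊆G₀ w) u le) })
  (toWitness {a? = 18 ℕ.≤? 2 * degree G₁ (# 5)} tt) cycle₀-misses

-- Closed neighbourhoods of adjacent vertices are nested. This form is checked on triples of
-- vertices instead of quadruples.
nested⇒quasiThreshold : ∀ {n} (G : Graph (Fin n)) →
  (∀ b c → Adj G b c → (∀ a → Adj G a b → a ≡ c ⊎ Adj G a c) ⊎ (∀ d → Adj G c d → b ≡ d ⊎ Adj G b d)) →
  QuasiThreshold G
nested⇒quasiThreshold G nested {a} {b} {c} {d} ab bc cd a≢c b≢d ¬ac ¬bd with nested b c bc
... | inj₁ p = [ a≢c , ¬ac ]′ (p a ab)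
... | inj₂ p = [ b≢d , ¬bd ]′ (p d cd)

G₀-quasiThreshold : QuasiThreshold G₀
G₀-quasiThreshold = nested⇒quasiThreshold G₀ (toWitness {a? = all? λ b → all? λ c → adj? G₀ b c →-dec
  ((all? λ a → adj? G₀ a b →-dec ((a ≟ c) ⊎-dec adj? G₀ a c))
   ⊎-dec (all? λ d → adj? G₀ c d →-dec ((b ≟ d) ⊎-dec adj? G₀ b d)))} tt)

G₁-triangleFree : TriangleFree G₁
G₁-triangleFree {a} {b} {c} ab bc ac = two-colours (side a) (side b) (side c) (proper a b ab) (proper b c bc) (proper a c ac)
  where
  side : Fin 18 → Bool
  side u = leaf (toℕ u) ∨ (toℕ u == 1) ∨ (toℕ u == 3) ∨ (toℕ u == 15) ∨ (toℕ u == 17)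
  proper : ∀ u v → Adj G₁ u v → side u ≢ side v
  proper = toWitness {a? = all? λ u → all? λ v → adj? G₁ u v →-dec ¬? (side u Bool.≟ side v)} tt
  two-colours : ∀ (p q r : Bool) → p ≢ q → q ≢ r → p ≢ r → ⊥
  two-colours false false _ pq _ _ = pq refl
  two-colours false true false _ _ pr = pr refl
  two-colours false true true _ qr _ = qr refl
  two-colours true true _ pq _ _ = pq refl
  two-colours true false true _ _ pr = pr refl
  two-colours true false false _ qr _ = qr refl

-- The longest cycle x 1 … 6 y 22 … 27 of G₂ (x = 0, y = 21) misses the heavy vertices
-- v = 7 and w = 20, which are joined to each other, to x and y respectively, and to
-- the three cliques K₄ on 8, …, 19.
block : ℕ → ℕ
block u = if u ℕ.<ᵇ 12 then 1 else if u ℕ.<ᵇ 16 then 2 else 3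

clique : ℕ → Bool
clique = between 8 19

-- With cliques of size q and two paths of q + 2 vertices between x and y, `v` and `w` have degree
-- 3q + 2 and n = 5q + 8, so q = 4 is the least size that makes them heavy. A passage through `v`
-- and `w` takes in only one clique and so does not beat a path of q + 2 vertices.
G₂ : Graph (Fin 28)
G₂ = fromEdges λ u v → edge′ (toℕ u) (toℕ v)
  where
  edge′ : ℕ → ℕ → Bool
  edge′ u v = ((suc u == v) ∧ ((v ℕ.≤ᵇ 6) ∨ (20 ℕ.≤ᵇ u))) ∨ ((u == 6) ∧ (v == 21)) ∨ ((u == 0) ∧ (v == 27))
            ∨ ((u == 0) ∧ (v == 7)) ∨ ((u == 7) ∧ (v == 20))
            ∨ (((u == 7) ∨ (u == 20)) ∧ clique v) ∨ (clique u ∧ clique v ∧ (block u == block v))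

module G₂-cycles where

  -- `coarse` labels the pieces left by deleting x and y; `fine` also splits the middle piece at `v`
  -- and `w`.
  coarse fine : Fin 28 → ℕ
  coarse u = if between 1 6 (toℕ u) then 1 else if between 7 20 (toℕ u) then 7 else if 22 ℕ.≤ᵇ toℕ u then 22 else toℕ u
  fine u = if clique (toℕ u) then 7 + block (toℕ u) else if (toℕ u == 7) then 12 else if (toℕ u == 20) then 20 else coarse u

  ends Z : List (Fin 28)
  ends = # 0 ∷ # 21 ∷ []
  Z = # 0 ∷ # 21 ∷ # 7 ∷ # 20 ∷ []

  coarse-separates : Separates G₂ ends coarse
  coarse-separates = toWitness {a? = separates? G₂ ends coarse} tt

  fine-separates : Separates G₂ Z fine
  fine-separates = toWitness {a? = separates? G₂ Z fine} tt

  module Coarse = Colouring G₂ coarse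
  module Fine = Colouring G₂ fine

  coarse≤14 : ∀ p → Coarse.class p ≤ 14
  coarse≤14 = toWitness {a? = all? λ p → Coarse.class p ℕ.≤? 14} tt

  x-class : ∀ p → Adj G₂ (# 0) p → p ∉ ends → p ≢ # 7 → Coarse.class p ≤ 6
  x-class = toWitness {a? = all? λ p → adj? G₂ (# 0) p →-dec (¬? (p ∈? ends) →-dec (¬? (p ≟ # 7) →-dec (Coarse.class p ℕ.≤? 6)))} tt

  w-class : ∀ p → Adj G₂ (# 20) p → p ∉ Z → Fine.class p ≤ 4
  w-class = toWitness {a? = all? λ p → adj? G₂ (# 20) p →-dec (¬? (p ∈? Z) →-dec (Fine.class p ℕ.≤? 4))} tt

  y-entry : ∀ p → Adj G₂ (# 21) p → coarse p ≡ 7 → p ≡ # 20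
  y-entry = toWitness {a? = all? λ p → adj? G₂ (# 21) p →-dec ((coarse p ℕ.≟ 7) →-dec (p ≟ # 20))} tt

  x-entries : ∀ p q → Adj G₂ (# 0) p → Adj G₂ (# 0) q → coarse q ≡ coarse p → q ≡ p
  x-entries = toWitness {a? = all? λ p → all? λ q → adj? G₂ (# 0) p →-dec (adj? G₂ (# 0) q →-dec ((coarse q ℕ.≟ coarse p) →-dec (q ≟ p)))} tt

  y-entries : ∀ p q → Adj G₂ (# 21) p → Adj G₂ (# 21) q → coarse q ≡ coarse p → q ≡ p
  y-entries = toWitness {a? = all? λ p → all? λ q → adj? G₂ (# 21) p →-dec (adj? G₂ (# 21) q →-dec ((coarse q ℕ.≟ coarse p) →-dec (q ≟ p)))} tt

  last-step : ∀ {a p l b} → Walk (Adj G₂) a (p ∷ l) b → ∃ λ m → ∃ λ q → p ∷ l ≡ m ++ ⟨ q ⟩ × Adj G₂ q b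
  last-step {p = p} {[]} (_ ∷ edge e) = [] , p , refl , e
  last-step {p = p} {q ∷ l} (_ ∷ w@(_ ∷ _)) with m , q , eq , e ← last-step w = p ∷ m , q , cong (p ∷_) eq , e

  -- The neighbours of z lie in different pieces.
  return : ∀ {z l} → (∀ p q → Adj G₂ z p → Adj G₂ z q → coarse q ≡ coarse p → q ≡ p) →
    Walk (Adj G₂) z l z → Unique l → Avoids G₂ ends l → length l ≤ 6
  return {l = []} _ _ _ _ = z≤n
  return {l = p ∷ []} _ _ _ _ = s≤s z≤n
  return {l = p ∷ p′ ∷ l} entries w@(e ∷ w′@(_ ∷ _)) u av with m , q , eq , f ← last-step w′ =
    ⊥-elim (∉-head u (subst (_∈ p′ ∷ l) (entries p q e (Graph.sym G₂ f)
      (All.lookup (Coarse.monochromatic {Z = ends} coarse-separates w av) (there q∈))) q∈))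
    where
    q∈ : q ∈ p′ ∷ l
    q∈ = subst (q ∈_) (sym eq) (∈-++⁺ʳ m (here refl))

  from-w : ∀ {m} → Walk (Adj G₂) (# 20) m (# 7) → Unique m → Avoids G₂ Z m → length m ≤ 4
  from-w {[]} _ _ _ = z≤n
  from-w {p ∷ m} w@(e ∷ _) u av = ℕ.≤-trans (Fine.walk-class {Z = Z} fine-separates w u av) (w-class p e (All.head av))

  from-y′ : ∀ {r m} → r ≡ # 20 → Walk (Adj G₂) r m (# 7) → Unique (# 7 ∷ r ∷ m) →
    Avoids G₂ ends (# 7 ∷ r ∷ m) → length (r ∷ m) ≤ 5
  from-y′ refl w u av = s≤s (from-w w (AllPairs.tail (AllPairs.tail u))
    (All.tabulate λ where
      i (here refl) → All.lookup av (there (there i)) (here refl)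
      i (there (here refl)) → All.lookup av (there (there i)) (there (here refl))
      i (there (there (here refl))) → ∉-head u (there i)
      i (there (there (there (here refl)))) → ∉-head (AllPairs.tail u) i))

  from-y : ∀ {m} → Walk (Adj G₂) (# 21) m (# 7) → Unique (# 7 ∷ m) → Avoids G₂ ends (# 7 ∷ m) → length m ≤ 5
  from-y {[]} _ _ _ = z≤n
  from-y {r ∷ m} (e ∷ w) u av = from-y′
    (y-entry r e (Coarse.endpoints {Z = ends} coarse-separates w (All.tail av) (All.head av))) w u av

  -- In the middle piece x sees only `v` and y sees only `w`, and between these two the walk stays
  -- in one `K₄`: at most 1 + 4 + 1 vertices.
  across : ∀ {l} → Walk (Adj G₂) (# 0) l (# 21) → Unique l → Avoids G₂ ends l → length l ≤ 6
  across {[]} _ _ _ = z≤n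
  across {p ∷ l} w@(e ∷ w′) u av = case p ≟ # 7 of λ where
    (no p≢) → ℕ.≤-trans (Coarse.walk-class {Z = ends} coarse-separates w u av) (x-class p e (All.head av) p≢)
    (yes refl) → s≤s (subst (_≤ 5) (length-reverse l) (from-y (walk-reverse (Graph.sym G₂) w′)
      (unique-resp-↭ (↭.prep _ (↭-sym (↭-reverse l))) u)
      (All.tabulate λ i → All.lookup av (∈-resp-↭ (↭.prep _ (↭-reverse l)) i))))

  -- A crude count is enough: the largest piece has 14 vertices, just the length of the cycle.
  inside : ∀ {a l} → Walk (Adj G₂) a l a → Unique (a ∷ l) → Avoids G₂ ends (a ∷ l) → length (a ∷ l) ≤ 14
  inside {l = []} _ _ _ = ℕ.m≤m+n 1 13
  inside {a} {p ∷ l} w u av with _ , q , _ , e ← last-step w =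
    ℕ.≤-trans (Coarse.walk-class {Z = ends} coarse-separates (e ∷ w) u av) (coarse≤14 a)

  bound : ∀ {a l} → IsCycle G₂ (Adj G₂) a l → suc (length l) ≤ 14
  bound = two-cut G₂ {k = 6} across (return x-entries) (return y-entries) inside

G₂-connected : 2 -Connected G₂
G₂-connected = 2-connected {G = G₂} (toWitness {a? = stNumbering? G₂} tt)

cycle₂ : List (Fin 28)
cycle₂ = # 1 ∷ # 2 ∷ # 3 ∷ # 4 ∷ # 5 ∷ # 6 ∷ # 21 ∷ # 22 ∷ # 23 ∷ # 24 ∷ # 25 ∷ # 26 ∷ # 27 ∷ []

G₂-bad : ¬ EveryLongestCycleHeavy G₂
G₂-bad = misses-heavy G₂ (toWitness {a? = isCycle? G₂ (# 0) cycle₂} tt) G₂-cycles.bound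
  (toWitness {a? = 28 ℕ.≤? 2 * degree G₂ (# 7)} tt) (toWitness {a? = ¬? (# 7 ∈? (# 0 ∷ cycle₂))} tt)

-- Four colours whose classes meet every neighbourhood in a clique.
colour₂ : Fin 28 → Fin 4
colour₂ = List.lookup
  (3F ∷ 1F ∷ 0F ∷ 0F ∷ 2F ∷ 1F ∷ 1F ∷ 0F ∷ 0F ∷ 0F ∷ 0F ∷ 0F ∷ 1F ∷ 1F ∷ 1F ∷ 1F ∷ 2F ∷ 2F ∷ 2F ∷ 2F ∷
   0F ∷ 3F ∷ 2F ∷ 0F ∷ 0F ∷ 1F ∷ 1F ∷ 2F ∷ [])

G₂-cliques : ∀ u a → Adj G₂ u a → ∀ b → Adj G₂ u b → a ≢ b → colour₂ a ≡ colour₂ b → Adj G₂ a b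
G₂-cliques = toWitness {a? = all? λ u → all? λ a → adj? G₂ u a →-dec (all? λ b →
  adj? G₂ u b →-dec (¬? (a ≟ b) →-dec ((colour₂ a ≟ colour₂ b) →-dec adj? G₂ a b)))} tt

G₂-star-free : ∀ {k} → 4 < k → star k -Free G₂
G₂-star-free = star-free {G = G₂} colour₂ G₂-cliques

-- Necessity and the two equivalences

free-resp-≅ : ∀ {m k n} {S : Graph (Fin m)} {T : Graph (Fin k)} {G : Graph (Fin n)} →
  S ≅ T → T -Free G → S -Free G
free-resp-≅ φ free W ψ = free W (≅-trans ψ φ)

free-necessary : ∀ {m} (S : Graph (Fin m)) → 3 ≤ m → Connected S →
  (∀ n (G : Graph (Fin n)) → 2 -Connected G → S -Free G → EveryLongestCycleHeavy G) →
  S ≅ path 3 ⊎ S ≅ star 3 ⊎ S ≅ star 4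
free-necessary {suc (suc (suc k))} S (s≤s (s≤s (s≤s _))) conn all-heavy = small k S (quasiThreshold⇒star conn
    (λ {a} {b} {c} ab bc ac → G₁-bad (all-heavy 18 G₁ G₁-connected (triangle-free {S = S} {G₁} (λ {a} {b} {c} → G₁-triangleFree {a} {b} {c}) ab bc ac)))
    (λ {a} {b} {c} {d} ab bc cd a≢c b≢d ¬ac ¬bd → G₀-bad (all-heavy 18 G₀ G₀-connected
      (quasiThreshold-free {S = S} {G₀} G₀-quasiThreshold ab bc cd a≢c b≢d ¬ac ¬bd)))) all-heavy
  where
  small : ∀ k (S : Graph (Fin (3 + k))) → S ≅ star (2 + k) →
    (∀ n (G : Graph (Fin n)) → 2 -Connected G → S -Free G → EveryLongestCycleHeavy G) →
    S ≅ path 3 ⊎ S ≅ star 3 ⊎ S ≅ star 4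
  small 0 S φ _ = inj₁ (≅-trans φ (≅-sym path3≅star2))
  small 1 S φ _ = inj₂ (inj₁ φ)
  small 2 S φ _ = inj₂ (inj₂ φ)
  small (suc (suc (suc k))) S φ all-heavy = ⊥-elim (G₂-bad (all-heavy 28 G₂ G₂-connected
    (free-resp-≅ {S = S} {star (5 + k)} {G₂} φ (G₂-star-free (ℕ.m≤m+n 5 k)))))

theorem5 : ∀ (m : ℕ) (S : Graph (Fin m)) → 3 ≤ m → Connected S →
    ((∀ (n : ℕ) (G : Graph (Fin n)) → 2 -Connected G → S -Free G → EveryLongestCycleHeavy G)
    ⇔ (S ≅ path 3 ⊎ S ≅ star 3 ⊎ S ≅ star 4))
    × ((∀ (n : ℕ) (G : Graph (Fin n)) → 2 -Connected G → S -Heavy G → EveryLongestCycleHeavy G)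
    ⇔ (S ≅ path 3 ⊎ S ≅ star 3 ⊎ S ≅ star 4))
-- Every `S`-free graph is `S`-heavy, so necessity is proved for free graphs, sufficiency for heavy
-- ones, and each serves both equivalences.
theorem5 m S 3≤m conn =
  mk⇔ (free-necessary S 3≤m conn)
      (λ φ n G 2conn free → heavy-sufficient φ n G 2conn (free⇒heavy {S = S} {G} free)) ,
  mk⇔ (λ all-heavy → free-necessary S 3≤m conn
        (λ n G 2conn free → all-heavy n G 2conn (free⇒heavy {S = S} {G} free)))
      heavy-sufficient
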